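{- Let $q$ be a prime power and $m\ge1$. Let $X\subseteq\mathbb{F}_q^m$ be a set of $n$ vectors which span $\mathbb{F}_q^m$, and let $\mathscr{M}=(X,\mathcal I)$ be the corresponding matroid (independent sets are the linearly independent subsets of $X$), of rank $m$. Let $\mathrm I(j)$ be the number of independent sets of size $j$. Then for all $1\le k<m$, $$\mathrm I(k)^2\ \ge\ \Bigl(1+\frac1k\Bigr)\Bigl(1+\frac{1}{q^{m-k+1}-2}\Bigr)\,\mathrm I(k-1)\,\mathrm I(k+1).$$
   Context: $\mathbb F_q$ is the finite field with $q$ elements. -}

module Defs where

open import Algebra.Apartness.Bundles using (HeytingField; HeytingCommutativeRing)
open import Algebra.Bundles using (CommutativeRing)
import Algebra.Properties.Monoid.Sum as MonoidSum
open import Data.Fin.Base using (Fin; finToFun; funToFin)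
import Data.Fin.Properties as Fin
open import Data.Fin.Subset using (Subset; inside; outside; _∉_; ∣_∣)
open import Data.Fin.Subset.Properties using (_∈?_)
open import Data.List.Base using (List; []; _∷_; _++_; map; filter; length)
open import Data.Nat.Base hiding (_⊔_)
open import Data.Nat.Primality using (Prime; prime⇒nonTrivial)
import Data.Nat.Properties as ℕ
import Data.Integer.Base as ℤ
open import Data.Rational.Base as ℚ using (ℚ)
open import Data.Product.Base using (∃; ∃₂; _×_; _,_)
import Data.Vec.Base as Vec
open import Data.Vec.Functional using (Vector; replicate)
import Data.Vec.Functional.Relation.Binary.Equality.Setoid as PointwiseEquality
open import Function.Base using (_∘_)
open import Function.Bundles using (Inverse)
open import Function.Definitions using (Injective)
open import Level using (Level; _⊔_) renaming (suc to lsuc)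
open import Relation.Binary.Definitions using (Decidable)
open import Relation.Binary.PropositionalEquality
  using (_≡_; refl) renaming (setoid to ≡-setoid)
open import Relation.Nullary.Decidable
  using (Dec; ¬?; _×-dec_; _→-dec_; map′)

IsPrimePower : ℕ → Set
IsPrimePower q = ∃₂ λ p e → Prime p × 1 ≤ e × q ≡ p ^ e

-- On a finite carrier invertibility is decidable, so the apartness of a
-- Heyting field is the negation of _≈_ and this is the usual notion of a
-- field with q elements.
record FiniteField (c ℓ₁ ℓ₂ : Level) (q : ℕ) : Set (lsuc (c ⊔ ℓ₁ ⊔ ℓ₂)) where
  field
    heytingField : HeytingField c ℓ₁ ℓ₂

  open HeytingField heytingField using (_#_; heytingCommutativeRing) public
  open HeytingCommutativeRing heytingCommutativeRing using (commutativeRing) public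
  open CommutativeRing commutativeRing public

  field
    enumeration : Inverse (≡-setoid (Fin q)) setoid

  module Enum = Inverse enumeration

  _≈?_ : Decidable _≈_
  x ≈? y = map′
    (λ e → trans (sym (Enum.strictlyInverseˡ x))
                 (trans (Enum.to-cong e) (Enum.strictlyInverseˡ y)))
    Enum.from-cong
    (Enum.from x Fin.≟ Enum.from y)

subsets : ∀ n → List (Subset n)
subsets zero    = Vec.[] ∷ []
subsets (suc n) = map (outside Vec.∷_) (subsets n) ++ map (inside Vec.∷_) (subsets n)

-- A set of n vectors in F^m is given by an enumeration X of its elements
-- without repetition (IsSet X), and its subsets by sets of indices.
module VectorSet {c ℓ₁ ℓ₂ q} (F : FiniteField c ℓ₁ ℓ₂ q)
                 {m n : ℕ} (X : Fin n → Vector (FiniteField.Carrier F) m) where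

  open FiniteField F using
    ( Carrier; _≈_; 0#; setoid; _≈?_; module Enum
    ; +-monoid; *-congʳ )
    renaming (_*_ to _*ᶠ_; sym to ≈-sym; trans to ≈-trans)
  open MonoidSum +-monoid using (sum; sum-cong-≋)
  open PointwiseEquality setoid using (_≋_)

  IsSet : Set ℓ₁
  IsSet = Injective _≡_ _≋_ X

  combination : Vector Carrier n → Vector Carrier m
  combination a j = sum λ i → a i *ᶠ X i j

  Spanning : Set (c ⊔ ℓ₁)
  Spanning = ∀ v → ∃ λ a → combination a ≋ v

  SupportedOn : Subset n → Vector Carrier n → Set ℓ₁
  SupportedOn S a = ∀ i → i ∉ S → a i ≈ 0#

  Independent : Subset n → Set (c ⊔ ℓ₁)
  Independent S = ∀ a → SupportedOn S a → combination a ≋ replicate m 0# → a ≋ replicate n 0#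

  private
    NoRelation : Subset n → Vector Carrier n → Set ℓ₁
    NoRelation S a = SupportedOn S a → combination a ≋ replicate m 0# → a ≋ replicate n 0#

    noRelation? : ∀ S a → Dec (NoRelation S a)
    noRelation? S a =
      Fin.all? (λ i → ¬? (i ∈? S) →-dec (a i ≈? 0#)) →-dec
      (Fin.all? (λ j → combination a j ≈? 0#) →-dec
       Fin.all? (λ i → a i ≈? 0#))

    noRelation-resp : ∀ S {a b} → a ≋ b → NoRelation S a → NoRelation S b
    noRelation-resp S a≋b h supp rel i =
      ≈-trans (≈-sym (a≋b i))
        (h (λ i i∉S → ≈-trans (a≋b i) (supp i i∉S))
           (λ j → ≈-trans (sum-cong-≋ (λ i → *-congʳ (a≋b i))) (rel j))
           i)

    vector : Fin (q ^ n) → Vector Carrier n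
    vector t = Enum.to ∘ finToFun t

    vector-surjective : ∀ a → vector (funToFin (Enum.from ∘ a)) ≋ a
    vector-surjective a i =
      ≈-trans (Enum.to-cong (Fin.finToFun-funToFin (Enum.from ∘ a) i))
              (Enum.strictlyInverseˡ (a i))

  independent? : ∀ S → Dec (Independent S)
  independent? S = map′
    (λ h a → noRelation-resp S (vector-surjective a) (h (funToFin (Enum.from ∘ a))))
    (λ h t → h (vector t))
    (Fin.all? (λ t → noRelation? S (vector t)))

  I : ℕ → ℕ
  I j = length (filter (λ S → (∣ S ∣ ℕ.≟ j) ×-dec independent? S) (subsets n))

primePower⇒2≤ : ∀ {q} → IsPrimePower q → 2 ≤ q
primePower⇒2≤ (p , e , p-prime , 1≤e , refl) = begin
  2      ≤⟨ nonTrivial⇒n>1 p {{prime⇒nonTrivial p-prime}} ⟩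
  p      ≡⟨ ℕ.^-identityʳ p ⟨
  p ^ 1  ≤⟨ ℕ.^-monoʳ-≤ p {{nonTrivial⇒nonZero p {{prime⇒nonTrivial p-prime}}}} 1≤e ⟩
  p ^ e  ∎
  where open ℕ.≤-Reasoning

q^[m-k+1]-2-nonZero : ∀ {q m k} → IsPrimePower q → k < m → NonZero (q ^ (m ∸ k + 1) ∸ 2)
q^[m-k+1]-2-nonZero {q} {m} {k} pp k<m = >-nonZero (ℕ.m<n⇒0<n∸m (begin
  3                ≤⟨ ℕ.n≤1+n 3 ⟩
  2 ^ 2            ≤⟨ ℕ.^-monoˡ-≤ 2 2≤q ⟩
  q ^ 2            ≤⟨ ℕ.^-monoʳ-≤ q {{>-nonZero (ℕ.<-trans z<s 2≤q)}}
                        (ℕ.+-monoˡ-≤ 1 (ℕ.m<n⇒0<n∸m k<m)) ⟩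
  q ^ (m ∸ k + 1)  ∎))
  where
  open ℕ.≤-Reasoning
  2≤q = primePower⇒2≤ pp

ℕ→ℚ : ℕ → ℚ
ℕ→ℚ n = ℤ.+ n ℚ./ 1

{-# OPTIONS --safe #-}
-- Following Brändén and Leake, f = ∑ a_|S| w₀^(k+1-|S|)/(k+1-|S|)! · w^S, summed over the independent sets S with
-- |S| ≤ k+1, is shown to be Lorentzian: if the Hessians of all derivatives ∂ᵢ f have at most one positive
-- eigenvalue, then so has the Hessian of ∑ᵢ ∂ᵢ f, because ∂ᵢ∂ⱼ f = ∂ⱼ∂ᵢ f forces the forms being added to be
-- nonpositive on a common hyperplane. This reduces everything to quadratic forms attached to the contractions M/S,
-- which are governed by the parallel classes of M/S. The number p of these classes satisfies (p+1) q^|S| ≤ q^m, since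
-- the span of S and its translates by representatives of the classes are disjoint; this permits the weights
-- a_j = q^(m-k+1) - 1 for j < k and a_j = q^(m-k+1) - 2 for j ≥ k. The reverse Cauchy–Schwarz inequality for w₀ and
-- w₁ + ⋯ + wₙ is then the claim.
module Submission where

open import Defs

-- The two factors of the claim have separate origins. Reverse Cauchy-Schwarz compares j! a_j I(j)
-- for j = k-1, k, k+1: the factorials give 1 + 1/k, and the drop of the weights from d + 1 to d,
-- with d = q^(m-k+1) - 2, gives 1 + 1/d. What limits the drop is the form at an independent S: with
-- p parallel classes and a, b, c the weights of sizes |S|, |S|+1, |S|+2, it is hyperbolic as soon
-- as (ac - b²) p ≤ ac. This is automatic when a = b ≥ c; at |S| = k-1 it reads p ≤ d + 1, which is
-- exactly what the count of cosets provides. The sum of derivatives is reached only as a limit: N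
-- ∑ᵢ ∂ᵢ f is added to ∂₀ f, and ∂₀ f disappears as N grows. Phrasing "at most one positive
-- eigenvalue" as a polynomial inequality over ℤ makes this limit elementary: a strict failure is a
-- failure by at least 1, so an explicit N refutes it.

-- Integral quadratic forms with at most one positive eigenvalue.

module QuadraticForms where

  open import Algebra.Bundles using (CommutativeRing)
  open import Data.Fin.Base using (Fin; zero; suc)
  open import Data.Fin.Properties using (suc-injective)
  open import Data.Integer.Base hiding (suc)
  open import Data.Integer.Properties
  open import Data.Integer.Solver using (module +-*-Solver)
  open import Data.Nat.Base as ℕ using (ℕ; zero; suc)
  open import Data.Vec.Functional using (Vector)
  open import Function.Base using (_∘_)
  open import Relation.Binary.PropositionalEquality
  open import Relation.Nullary.Decidable using (yes; no)
  open import Relation.Nullary.Negation using (contradiction)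
  open import Algebra.Properties.Semiring.Sum (CommutativeRing.semiring +-*-commutativeRing) public
    using (sum; sum-cong-≗; ∑-distrib-+; ∑-comm; *-distribˡ-sum; *-distribʳ-sum; sum-replicate-zero)
  open +-*-Solver using (solve; _:=_; _:+_; _:*_; _:-_; :-_; con)

  +-nonneg : ∀ {i j} → 0ℤ ≤ i → 0ℤ ≤ j → 0ℤ ≤ i + j
  +-nonneg = +-mono-≤

  *-nonneg : ∀ {i j} → 0ℤ ≤ i → 0ℤ ≤ j → 0ℤ ≤ i * j
  *-nonneg {+ m} {+ n} _ _ = subst (0ℤ ≤_) (pos-* m n) (+≤+ ℕ.z≤n)

  square-nonneg : ∀ i → 0ℤ ≤ i * i
  square-nonneg (+ n)    = *-nonneg {+ n} {+ n} (+≤+ ℕ.z≤n) (+≤+ ℕ.z≤n)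
  square-nonneg -[1+ n ] = +≤+ ℕ.z≤n

  *-pos : ∀ {i j} → 0ℤ < i → 0ℤ < j → 0ℤ < i * j
  *-pos {+[1+ m ]} {+[1+ n ]} _ _ = +<+ (ℕ.s≤s ℕ.z≤n)
  *-pos {+ zero} (+<+ ())
  *-pos {+[1+ m ]} {+ zero} _ (+<+ ())

  square-pos : ∀ {i} → i ≢ 0ℤ → 0ℤ < i * i
  square-pos {+ zero}   i≢0 = contradiction refl i≢0
  square-pos {+[1+ n ]} _   = +<+ (ℕ.s≤s ℕ.z≤n)
  square-pos { -[1+ n ]} _  = +<+ (ℕ.s≤s ℕ.z≤n)

  *-cancel-nonneg : ∀ {i j} → 0ℤ < i → 0ℤ ≤ i * j → 0ℤ ≤ j
  *-cancel-nonneg {+[1+ m ]} {j} _ h =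
    *-cancelˡ-≤-pos 0ℤ j +[1+ m ] (subst (_≤ +[1+ m ] * j) (sym (*-zeroʳ +[1+ m ])) h)
  *-cancel-nonneg {+ zero} (+<+ ())

  0<i⇒0≤i-1 : ∀ {i} → 0ℤ < i → 0ℤ ≤ i - 1ℤ
  0<i⇒0≤i-1 0<i = i≤j⇒0≤j-i (i<j⇒suc[i]≤j 0<i)

  0≤∣i∣+i : ∀ i → 0ℤ ≤ + ∣ i ∣ + i
  0≤∣i∣+i (+ n)    = +≤+ ℕ.z≤n
  0≤∣i∣+i -[1+ n ] = ≤-reflexive (sym (n⊖n≡0 (suc n)))

  sum-zero : ∀ {n} {f : Vector ℤ n} → (∀ i → f i ≡ 0ℤ) → sum f ≡ 0ℤ
  sum-zero {n} h = trans (sum-cong-≗ h) (sum-replicate-zero n)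

  sum-nonneg : ∀ {n} {f : Vector ℤ n} → (∀ i → 0ℤ ≤ f i) → 0ℤ ≤ sum f
  sum-nonneg {zero}  h = ≤-refl
  sum-nonneg {suc n} h = +-nonneg (h zero) (sum-nonneg (h ∘ suc))

  sum≡0⇒≡0 : ∀ {n} {f : Vector ℤ n} → (∀ i → 0ℤ ≤ f i) → sum f ≡ 0ℤ → ∀ i → f i ≡ 0ℤ
  sum≡0⇒≡0 {suc n} {f} h e zero = ≤-antisym
    (subst (f zero ≤_) e (subst (_≤ f zero + sum (f ∘ suc)) (+-identityʳ (f zero))
      (+-monoʳ-≤ (f zero) (sum-nonneg (h ∘ suc)))))
    (h zero)
  sum≡0⇒≡0 {suc n} {f} h e (suc i) = sum≡0⇒≡0 (h ∘ suc)
    (≤-antisym (subst (sum (f ∘ suc) ≤_) e (subst (_≤ f zero + sum (f ∘ suc)) (+-identityˡ _)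
      (+-monoˡ-≤ (sum (f ∘ suc)) (h zero))))
      (sum-nonneg (h ∘ suc))) i

  sum-single : ∀ {p} {f : Vector ℤ p} r → (∀ s → s ≢ r → f s ≡ 0ℤ) → sum f ≡ f r
  sum-single {suc p} {f} zero    e = trans
    (cong (λ t → f zero + t) (sum-zero λ s → e (suc s) λ ())) (+-identityʳ (f zero))
  sum-single {suc p} {f} (suc r) e = trans
    (cong₂ _+_ (e zero λ ()) (sum-single r λ s s≢r → e (suc s) (s≢r ∘ suc-injective)))
    (+-identityˡ (f (suc r)))

  Matrix : ℕ → Set
  Matrix n = Fin n → Fin n → ℤ

  Symmetric : ∀ {n} → Matrix n → Set
  Symmetric M = ∀ i j → M i j ≡ M j i

  infixl 7 _∗_
  _∗_ : ∀ {n} → Matrix n → Vector ℤ n → Vector ℤ n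
  (M ∗ y) i = sum λ j → M i j * y j

  form : ∀ {n} → Matrix n → Vector ℤ n → Vector ℤ n → ℤ
  form M x y = sum λ i → x i * (M ∗ y) i

  linear : ∀ {n} → ℤ → Vector ℤ n → ℤ → Vector ℤ n → Vector ℤ n
  linear α x β y i = α * x i + β * y i

  basis : ∀ {n} → Fin n → Vector ℤ n
  basis zero    zero    = 1ℤ
  basis zero    (suc j) = 0ℤ
  basis (suc i) zero    = 0ℤ
  basis (suc i) (suc j) = basis i j

  sum-linear : ∀ {n} α (f : Vector ℤ n) β g → sum (linear α f β g) ≡ α * sum f + β * sum g
  sum-linear α f β g = trans (∑-distrib-+ (λ i → α * f i) (λ i → β * g i))
    (sym (cong₂ _+_ (*-distribˡ-sum α f) (*-distribˡ-sum β g)))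

  sum-basis : ∀ {n} (k : Fin n) (f : Vector ℤ n) → sum (λ i → f i * basis k i) ≡ f k
  sum-basis {suc n} zero f = trans (cong₂ _+_ (*-identityʳ (f zero)) (sum-zero λ i → *-zeroʳ (f (suc i))))
    (+-identityʳ (f zero))
  sum-basis {suc n} (suc k) f = trans (cong₂ _+_ (*-zeroʳ (f zero)) (sum-basis k (f ∘ suc)))
    (+-identityˡ (f (suc k)))

  module _ {n} (M : Matrix n) where

    ∗-linear : ∀ α x β y i → (M ∗ linear α x β y) i ≡ α * (M ∗ x) i + β * (M ∗ y) i
    ∗-linear α x β y i = trans
      (sum-cong-≗ λ j → solve 5 (λ a b c d e → e :* (a :* b :+ c :* d) := a :* (e :* b) :+ c :* (e :* d))
        refl α (x j) β (y j) (M i j))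
      (sum-linear α (λ j → M i j * x j) β (λ j → M i j * y j))

    form-linearˡ : ∀ α x β y z → form M (linear α x β y) z ≡ α * form M x z + β * form M y z
    form-linearˡ α x β y z = trans
      (sum-cong-≗ λ j → solve 5 (λ a b c d e → (a :* b :+ c :* d) :* e := a :* (b :* e) :+ c :* (d :* e))
        refl α (x j) β (y j) ((M ∗ z) j))
      (sum-linear α (λ j → x j * (M ∗ z) j) β (λ j → y j * (M ∗ z) j))

    ∗-basis : ∀ k i → (M ∗ basis k) i ≡ M i k
    ∗-basis k i = sum-basis k (M i)

    form-basisˡ : ∀ k y → form M (basis k) y ≡ (M ∗ y) k
    form-basisˡ k y = trans (sum-cong-≗ λ i → *-comm (basis k i) ((M ∗ y) i)) (sum-basis k (M ∗ y))

    form-sym : Symmetric M → ∀ x y → form M x y ≡ form M y x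
    form-sym M-sym x y = trans (sum-cong-≗ λ i → *-distribˡ-sum (x i) (λ j → M i j * y j))
      (trans (∑-comm λ i j → x i * (M i j * y j))
      (sym (trans (sum-cong-≗ λ j → *-distribˡ-sum (y j) (λ i → M j i * x i))
        (sum-cong-≗ λ j → sum-cong-≗ λ i →
          trans (solve 3 (λ a b c → a :* (b :* c) := c :* (b :* a)) refl (y j) (M j i) (x i))
                (cong (λ e → x i * (e * y j)) (M-sym j i))))))

    form-square : Symmetric M → ∀ α x β y → form M (linear α x β y) (linear α x β y) ≡
      α * α * form M x x + (α * β + α * β) * form M x y + β * β * form M y y
    form-square M-sym α x β y = trans (form-linearˡ α x β y z)
      (trans (cong₂ (λ s t → α * s + β * t) (expand x)
          (trans (expand y) (cong (λ e → α * e + β * form M y y) (form-sym M-sym y x))))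
        (solve 5 (λ a b p q r → a :* (a :* p :+ b :* q) :+ b :* (a :* q :+ b :* r)
                   := a :* a :* p :+ (a :* b :+ a :* b) :* q :+ b :* b :* r)
          refl α β (form M x x) (form M x y) (form M y y)))
      where
      z = linear α x β y
      expand : ∀ w → form M w z ≡ α * form M w x + β * form M w y
      expand w = trans (form-sym M-sym w z) (trans (form-linearˡ α x β y w)
        (cong₂ (λ s t → α * s + β * t) (form-sym M-sym x w) (form-sym M-sym y w)))

    form-nonneg : (∀ i j → 0ℤ ≤ M i j) → ∀ {x y} → (∀ i → 0ℤ ≤ x i) → (∀ i → 0ℤ ≤ y i) → 0ℤ ≤ form M x y
    form-nonneg 0≤M 0≤x 0≤y =
      sum-nonneg λ i → *-nonneg (0≤x i) (sum-nonneg λ j → *-nonneg (0≤M i j) (0≤y j))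

  ∗-cong : ∀ {n} {M M′ : Matrix n} → (∀ i j → M i j ≡ M′ i j) → ∀ x i → (M ∗ x) i ≡ (M′ ∗ x) i
  ∗-cong e x i = sum-cong-≗ λ j → cong (_* x j) (e i j)

  form-cong : ∀ {n} {M M′ : Matrix n} → (∀ i j → M i j ≡ M′ i j) → ∀ x y → form M x y ≡ form M′ x y
  form-cong e x y = sum-cong-≗ λ i → cong (x i *_) (∗-cong e y i)

  infixl 6 _+[_]_
  _+[_]_ : ∀ {n} → Matrix n → ℤ → Matrix n → Matrix n
  (M +[ c ] M′) i j = M i j + c * M′ i j

  form-+[] : ∀ {n} (M : Matrix n) c M′ x y → form (M +[ c ] M′) x y ≡ form M x y + c * form M′ x y
  form-+[] M c M′ x y = trans (sum-cong-≗ λ i → trans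
      (cong (x i *_) (trans
        (sum-cong-≗ λ j → solve 4 (λ a b c d → (a :+ b :* c) :* d := con 1ℤ :* (a :* d) :+ b :* (c :* d))
          refl (M i j) c (M′ i j) (y j))
        (sum-linear 1ℤ (λ j → M i j * y j) c (λ j → M′ i j * y j))))
      (solve 4 (λ a b c d → d :* (con 1ℤ :* a :+ b :* c) := con 1ℤ :* (d :* a) :+ b :* (d :* c))
        refl ((M ∗ y) i) c ((M′ ∗ y) i) (x i)))
    (trans (sum-linear 1ℤ (λ i → x i * (M ∗ y) i) c (λ i → x i * (M′ ∗ y) i))
      (cong (_+ c * form M′ x y) (*-identityˡ (form M x y))))

  -- For a symmetric matrix: at most one positive eigenvalue.
  record Hyperbolic {n} (M : Matrix n) : Set where
    constructor mkHyperbolic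
    field
      reverseCauchySchwarz : ∀ x y → 0ℤ < form M x x → form M x x * form M y y ≤ form M x y * form M x y

  open Hyperbolic

  hyperbolic-cong : ∀ {n} {M M′ : Matrix n} → (∀ i j → M i j ≡ M′ i j) → Hyperbolic M → Hyperbolic M′
  hyperbolic-cong {M = M} {M′} e h = mkHyperbolic rcs
    where
    rcs : ∀ x y → 0ℤ < form M′ x x → form M′ x x * form M′ y y ≤ form M′ x y * form M′ x y
    rcs x y rewrite sym (form-cong e x x) | sym (form-cong e y y) | sym (form-cong e x y) =
      reverseCauchySchwarz h x y

  zero-hyperbolic : ∀ {n} {M : Matrix n} → (∀ i j → M i j ≡ 0ℤ) → Hyperbolic M
  zero-hyperbolic e = mkHyperbolic λ x y 0<xx → contradiction
    (sum-zero λ i → trans (cong (x i *_) (sum-zero λ j → trans (cong (_* x j) (e i j)) (*-zeroˡ (x j)))) (*-zeroʳ (x i)))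
    (≢-sym (<⇒≢ 0<xx))

  module _ {n} {M : Matrix n} (M-sym : Symmetric M) where

    -- The vector w = ℓ(x) y - ℓ(y) x lies in the kernel of ℓ, so the form is nonpositive at w.
    -- Multiplying by the positive value at x and completing the square yields ℓ(x)² times the
    -- desired inequality, and ℓ(x) ≠ 0 because the form is positive at x.
    negativeOnKernel⇒hyperbolic :
      (ℓ : Vector ℤ n → ℤ) → (∀ α x β y → ℓ (linear α x β y) ≡ α * ℓ x + β * ℓ y) →
      (∀ x → ℓ x ≡ 0ℤ → form M x x ≤ 0ℤ) → Hyperbolic M
    negativeOnKernel⇒hyperbolic ℓ ℓ-linear neg .reverseCauchySchwarz x y 0<xx with ℓ x ≟ 0ℤ
    ... | yes ℓx≡0 = contradiction (neg x ℓx≡0) (<⇒≱ 0<xx)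
    ... | no  ℓx≢0 = 0≤i-j⇒j≤i (*-cancel-nonneg (square-pos ℓx≢0) (subst (0ℤ ≤_) certificate
        (+-nonneg (square-nonneg (ℓ y * form M x x - ℓ x * form M x y))
                  (*-nonneg (<⇒≤ 0<xx) (neg-mono-≤ ww≤0)))))
      where
      w = linear (ℓ x) y (- ℓ y) x
      ww≤0 : form M w w ≤ 0ℤ
      ww≤0 = neg w (trans (ℓ-linear (ℓ x) y (- ℓ y) x)
        (solve 2 (λ a b → a :* b :+ :- b :* a := con 0ℤ) refl (ℓ x) (ℓ y)))
      certificate :
        (ℓ y * form M x x - ℓ x * form M x y) * (ℓ y * form M x x - ℓ x * form M x y)
          + form M x x * - form M w w
        ≡ ℓ x * ℓ x * (form M x y * form M x y - form M x x * form M y y)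
      certificate = trans (cong (λ e → t * t + form M x x * - e) ww-expand)
        (solve 5 (λ a b p q r →
            (b :* p :- a :* q) :* (b :* p :- a :* q)
              :+ p :* :- (a :* a :* r :+ (a :* :- b :+ a :* :- b) :* q :+ :- b :* :- b :* p)
            := a :* a :* (q :* q :- p :* r))
          refl (ℓ x) (ℓ y) (form M x x) (form M x y) (form M y y))
        where
        t = ℓ y * form M x x - ℓ x * form M x y
        ww-expand : form M w w ≡ ℓ x * ℓ x * form M y y + (ℓ x * - ℓ y + ℓ x * - ℓ y) * form M x y
                                   + - ℓ y * - ℓ y * form M x x
        ww-expand = trans (form-square M M-sym (ℓ x) y (- ℓ y) x)
          (cong (λ e → ℓ x * ℓ x * form M y y + (ℓ x * - ℓ y + ℓ x * - ℓ y) * e + - ℓ y * - ℓ y * form M x x)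
            (form-sym M M-sym y x))

    -- If the form were positive at x, reverse Cauchy-Schwarz for x and y = s v + z would fail for
    -- large s: the pairing of x with y does not depend on s, while the value at y grows. The
    -- auxiliary z allows the form to vanish at v, where v alone would give no contradiction.
    hyperbolic⇒negativeOnKernel : Hyperbolic M → ∀ {v z} → 0ℤ ≤ form M v v → 0ℤ < form M v z →
      ∀ x → form M v x ≡ 0ℤ → form M x x ≤ 0ℤ
    hyperbolic⇒negativeOnKernel hyp {v} {z} 0≤vv 0<vz x vx≡0 with form M x x ≤? 0ℤ
    ... | yes xx≤0 = xx≤0
    ... | no  xx≰0 = contradiction bound (<⇒≱ (<-≤-trans xz²<yy yy≤xx*yy))
      where
      vv = form M v v ; vz = form M v z ; zz = form M z z ; xx = form M x x ; xz = form M x z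
      0<xx : 0ℤ < xx
      0<xx = ≰⇒> xx≰0
      -- Large enough that the value at `y` is at least 1 + `xz`², whatever the sign of `zz`.
      s = 1ℤ + (xz * xz + + ∣ zz ∣)
      0≤∣zz∣ : 0ℤ ≤ + ∣ zz ∣
      0≤∣zz∣ = +≤+ ℕ.z≤n
      0≤s : 0ℤ ≤ s
      0≤s = +-nonneg (+≤+ ℕ.z≤n) (+-nonneg (square-nonneg xz) 0≤∣zz∣)
      y = linear s v 1ℤ z
      yy = s * s * vv + (s * 1ℤ + s * 1ℤ) * vz + 1ℤ * 1ℤ * zz
      bound : xx * yy ≤ xz * xz
      bound = subst₂ _≤_ (cong (xx *_) (form-square M M-sym s v 1ℤ z))
        (cong (λ e → e * e) xy≡xz) (reverseCauchySchwarz hyp x y 0<xx)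
        where
        xy≡xz : form M x y ≡ xz
        xy≡xz = trans (form-sym M M-sym x y) (trans (form-linearˡ M s v 1ℤ z x)
          (trans (cong₂ (λ e e′ → s * e + 1ℤ * e′) vx≡0 (form-sym M M-sym z x))
            (solve 2 (λ a b → a :* con 0ℤ :+ con 1ℤ :* b := b) refl s xz)))
      slack : 0ℤ ≤ yy - (1ℤ + xz * xz)
      slack = subst (0ℤ ≤_)
        (solve 5 (λ q u a b w → let s = con 1ℤ :+ (q :+ u) in
              s :* s :* a :+ ((s :+ s) :* (b :- con 1ℤ) :+ (con 1ℤ :+ (q :+ (u :+ (u :+ w)))))
              := (s :* s :* a :+ (s :* con 1ℤ :+ s :* con 1ℤ) :* b :+ con 1ℤ :* con 1ℤ :* w) :- (con 1ℤ :+ q))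
          refl (xz * xz) (+ ∣ zz ∣) vv vz zz)
        (+-nonneg (*-nonneg (square-nonneg s) 0≤vv)
          (+-nonneg (*-nonneg (+-nonneg 0≤s 0≤s) (0<i⇒0≤i-1 0<vz))
            (+-nonneg (+≤+ ℕ.z≤n) (+-nonneg (square-nonneg xz) (+-nonneg 0≤∣zz∣ (0≤∣i∣+i zz))))))
      xz²<yy : xz * xz < yy
      xz²<yy = suc[i]≤j⇒i<j (0≤i-j⇒j≤i slack)
      yy≤xx*yy : yy ≤ xx * yy
      yy≤xx*yy = 0≤i-j⇒j≤i (subst (0ℤ ≤_) (solve 2 (λ a b → (a :- con 1ℤ) :* b := a :* b :- b) refl xx yy)
        (*-nonneg (0<i⇒0≤i-1 0<xx) (≤-trans (square-nonneg xz) (<⇒≤ xz²<yy))))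


  0≤∣i∣-i : ∀ i → 0ℤ ≤ + ∣ i ∣ - i
  0≤∣i∣-i i = subst (λ e → 0ℤ ≤ + e - i) (∣-i∣≡∣i∣ i) (0≤∣i∣+i (- i))

  -- The two forms agree on the functional ℓ = B e_k = C u, and both are nonpositive on its kernel.
  hyperbolic-+ : ∀ {n} {B C : Matrix n} → Symmetric B → Symmetric C → Hyperbolic B → Hyperbolic C →
    ∀ {c} → 0ℤ ≤ c → ∀ k u → (∀ i → (C ∗ u) i ≡ B i k) →
    0ℤ ≤ B k k → 0ℤ ≤ form C u u → ∀ {i} → 0ℤ < B i k → Hyperbolic (B +[ c ] C)
  hyperbolic-+ {B = B} {C} B-sym C-sym B-hyp C-hyp {c} 0≤c k u Cu≡Bk 0≤Bkk 0≤Cuu {i} 0<Bik =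
    negativeOnKernel⇒hyperbolic (λ i j → cong₂ (λ s t → s + c * t) (B-sym i j) (C-sym i j))
      ℓ (λ α x β y → ∗-linear B α x β y k)
      (λ x ℓx≡0 → subst (_≤ 0ℤ) (sym (form-+[] B c C x x))
        (+-mono-≤ (B-neg x ℓx≡0) (*-nonPos (C-neg x ℓx≡0))))
    where
    ℓ : Vector ℤ _ → ℤ
    ℓ x = (B ∗ x) k
    *-nonPos : ∀ {j} → j ≤ 0ℤ → c * j ≤ 0ℤ
    *-nonPos {j} j≤0 = neg-cancel-≤ (subst (0ℤ ≤_) (sym (neg-distribʳ-* c j)) (*-nonneg 0≤c (neg-mono-≤ j≤0)))
    Be≡ℓ : ∀ x → form B (basis k) x ≡ ℓ x
    Be≡ℓ = form-basisˡ B k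
    Cu≡ℓ : ∀ x → form C u x ≡ ℓ x
    Cu≡ℓ x = trans (form-sym C C-sym u x)
      (sum-cong-≗ λ j → trans (cong (x j *_) (trans (Cu≡Bk j) (B-sym j k))) (*-comm (x j) (B k j)))
    ℓe≡B : ∀ j → ℓ (basis j) ≡ B j k
    ℓe≡B j = trans (∗-basis B j k) (B-sym k j)
    B-neg : ∀ x → ℓ x ≡ 0ℤ → form B x x ≤ 0ℤ
    B-neg x ℓx≡0 = hyperbolic⇒negativeOnKernel B-sym B-hyp {basis k} {basis i}
      (subst (0ℤ ≤_) (sym (trans (Be≡ℓ (basis k)) (ℓe≡B k))) 0≤Bkk)
      (subst (0ℤ <_) (sym (trans (Be≡ℓ (basis i)) (ℓe≡B i))) 0<Bik)
      x (trans (Be≡ℓ x) ℓx≡0)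
    C-neg : ∀ x → ℓ x ≡ 0ℤ → form C x x ≤ 0ℤ
    C-neg x ℓx≡0 = hyperbolic⇒negativeOnKernel C-sym C-hyp {u} {basis i} 0≤Cuu
      (subst (0ℤ <_) (sym (trans (Cu≡ℓ (basis i)) (ℓe≡B i))) 0<Bik)
      x (trans (Cu≡ℓ x) ℓx≡0)

  -- For fixed x and y the defect of reverse Cauchy-Schwarz for M + N M′ is the quadratic polynomial
  -- β + N α - N² (ac - b²) in N. If the inequality failed for M′, then ac - b² ≥ 1 and this would
  -- be negative for large N.
  hyperbolic-limit : ∀ {n} {M M′ : Matrix n} → (∀ (N : ℕ) → Hyperbolic (M +[ + N ] M′)) → Hyperbolic M′
  hyperbolic-limit {M = M} {M′} hyp .reverseCauchySchwarz x y 0<a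
    with form M′ x x * form M′ y y ≤? form M′ x y * form M′ x y
  ... | yes ac≤b² = ac≤b²
  ... | no  ac≰b² = contradiction (+-nonneg upper lower) (λ h → <⇒≱ -<+ (subst (0ℤ ≤_) (cancel E) h))
    where
    a = form M′ x x ; b = form M′ x y ; c = form M′ y y
    a₀ = form M x x ; b₀ = form M x y ; c₀ = form M y y
    α = (b * b₀ + b * b₀) - a * c₀ - c * a₀
    β = b₀ * b₀ - a₀ * c₀
    -- The summand for `a₀` makes M + N M′ positive at `x`; those for `α` and `β` let the leading
    -- term outweigh the rest.
    N = 1 ℕ.+ (∣ α ∣ ℕ.+ (∣ β ∣ ℕ.+ ∣ a₀ ∣))
    0≤+ : ∀ {m} → 0ℤ ≤ + m
    0≤+ = +≤+ ℕ.z≤n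
    A B C E : ℤ
    A = a₀ + + N * a
    B = b₀ + + N * b
    C = c₀ + + N * c
    E = B * B - A * C
    0<A : 0ℤ < A
    0<A = suc[i]≤j⇒i<j (0≤i-j⇒j≤i (subst (0ℤ ≤_)
      (solve 5 (λ a a₀ p q r → let N = con 1ℤ :+ (p :+ (q :+ r)) in
          (r :+ a₀) :+ (N :* (a :- con 1ℤ) :+ (p :+ q)) := (a₀ :+ N :* a) :- (con 1ℤ :+ con 0ℤ))
        refl a a₀ (+ ∣ α ∣) (+ ∣ β ∣) (+ ∣ a₀ ∣))
      (+-nonneg (0≤∣i∣+i a₀) (+-nonneg (*-nonneg {+ N} 0≤+ (0<i⇒0≤i-1 0<a)) 0≤+))))
    upper : 0ℤ ≤ E
    upper = i≤j⇒0≤j-i (subst₂ _≤_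
      (cong₂ _*_ (form-+[] M (+ N) M′ x x) (form-+[] M (+ N) M′ y y))
      (cong₂ _*_ (form-+[] M (+ N) M′ x y) (form-+[] M (+ N) M′ x y))
      (reverseCauchySchwarz (hyp N) x y (subst (0ℤ <_) (sym (form-+[] M (+ N) M′ x x)) 0<A)))
    0≤D-1 : 0ℤ ≤ (a * c - b * b) - 1ℤ
    0≤D-1 = 0<i⇒0≤i-1 (subst (_< a * c - b * b) (+-inverseʳ (b * b)) (+-monoˡ-< (- (b * b)) (≰⇒> ac≰b²)))
    lower : 0ℤ ≤ - E - 1ℤ
    lower = subst (0ℤ ≤_)
      (solve 9 (λ a b c a₀ b₀ c₀ p q r →
          let N = con 1ℤ :+ (p :+ (q :+ r))
              α = (b :* b₀ :+ b :* b₀) :- a :* c₀ :- c :* a₀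
              β = b₀ :* b₀ :- a₀ :* c₀ in
          N :* N :* ((a :* c :- b :* b) :- con 1ℤ)
            :+ (N :* (p :- α) :+ ((q :- β) :+ ((p :+ (q :+ r)) :+ (N :* r :+ (p :+ (q :+ r)) :* q))))
          := :- ((b₀ :+ N :* b) :* (b₀ :+ N :* b) :- (a₀ :+ N :* a) :* (c₀ :+ N :* c)) :- con 1ℤ)
        refl a b c a₀ b₀ c₀ (+ ∣ α ∣) (+ ∣ β ∣) (+ ∣ a₀ ∣))
      (+-nonneg (*-nonneg {+ N * + N} (square-nonneg (+ N)) 0≤D-1)
        (+-nonneg (*-nonneg {+ N} 0≤+ (0≤∣i∣-i α)) (+-nonneg (0≤∣i∣-i β)
          (+-nonneg 0≤+ (+-nonneg (*-nonneg {+ N} {+ ∣ a₀ ∣} 0≤+ 0≤+)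
            (*-nonneg {+ (∣ α ∣ ℕ.+ (∣ β ∣ ℕ.+ ∣ a₀ ∣))} {+ ∣ β ∣} 0≤+ 0≤+))))))
    cancel : ∀ e → e + (- e - 1ℤ) ≡ -1ℤ
    cancel = solve 1 (λ e → e :+ (:- e :- con 1ℤ) := con -1ℤ) refl

  sum-square-deviation : ∀ {p} w (f : Vector ℤ p) →
    sum (λ r → (f r - w) * (f r - w)) ≡ sum (λ r → f r * f r) - (w + w) * sum f + + p * (w * w)
  sum-square-deviation {zero}  w f = solve 1 (λ w → con 0ℤ := con 0ℤ :- (w :+ w) :* con 0ℤ :+ con 0ℤ :* (w :* w)) refl w
  sum-square-deviation {suc p} w f = trans
    (cong (λ e → (f zero - w) * (f zero - w) + e) (sum-square-deviation w (f ∘ suc)))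
    (solve 5 (λ w x s t p → (x :- w) :* (x :- w) :+ (t :- (w :+ w) :* s :+ p :* (w :* w))
          := (x :* x :+ t) :- (w :+ w) :* (x :+ s) :+ (con 1ℤ :+ p) :* (w :* w))
      refl w (f zero) (sum (f ∘ suc)) (sum (λ r → f (suc r) * f (suc r))) (+ p))

  -- Lagrange's identity, one entry at a time: a new entry x increases the difference by ∑ (f r -
  -- x)².
  cauchySchwarz : ∀ {p} (f : Vector ℤ p) → 0ℤ ≤ + p * sum (λ r → f r * f r) - sum f * sum f
  cauchySchwarz {zero}  f = ≤-refl
  cauchySchwarz {suc p} f = subst (0ℤ ≤_)
    (trans (cong (λ e → (+ p * t - s * s) + e) (sum-square-deviation x (f ∘ suc)))
      (solve 4 (λ x s t p → (p :* t :- s :* s) :+ (t :- (x :+ x) :* s :+ p :* (x :* x))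
          := (con 1ℤ :+ p) :* (x :* x :+ t) :- (x :+ s) :* (x :+ s)) refl x s t (+ p)))
    (+-nonneg (cauchySchwarz (f ∘ suc)) (sum-nonneg λ r → square-nonneg (f (suc r) - x)))
    where
    x = f zero
    s = sum (f ∘ suc)
    t = sum (λ r → f (suc r) * f (suc r))

  -- The matrix of a x₀² + 2b x₀ σ + c (σ² − ∑ᵣ Wᵣ²), where W₁, …, W_p are the sums of the variables over the
  -- classes of a partition and σ is their total. On the kernel of a x₀ + b σ, a times the form is
  -- (a c − b²) σ² − a c ∑ᵣ Wᵣ².
  module _ {n p} {M : Matrix (suc n)} (M-sym : Symmetric M) {a b c : ℤ}
    (member : Fin p → Fin n → ℤ) {loopless : Fin n → ℤ} {adjacent : Matrix n}
    (M₀₀ : M zero zero ≡ a) (M₀ : ∀ i → M zero (suc i) ≡ b * loopless i)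
    (Mᵢ : ∀ i j → M (suc i) (suc j) ≡ c * adjacent i j)
    (loopless-sum : ∀ i → loopless i ≡ sum λ r → member r i)
    (adjacent-sum : ∀ i j → adjacent i j ≡ loopless i * loopless j - sum λ r → member r i * member r j)
    (0<a : 0ℤ < a) (0≤c : 0ℤ ≤ c) (bound : 0ℤ ≤ a * c - (a * c - b * b) * + p) where

    partition-hyperbolic : Hyperbolic M
    partition-hyperbolic = negativeOnKernel⇒hyperbolic M-sym (λ x → (M ∗ x) zero)
      (λ α x β y → ∗-linear M α x β y zero) nonpositive
      where
      module _ (x : Vector ℤ (suc n)) (ℓx≡0 : (M ∗ x) zero ≡ 0ℤ) where
        x₀ = x zero
        xs = x ∘ suc
        W : Vector ℤ p
        W r = sum λ j → member r j * xs j
        σ = sum W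
        T = sum λ r → W r * W r

        sum-loopless : sum (λ j → loopless j * xs j) ≡ σ
        sum-loopless = trans
          (sum-cong-≗ λ j → trans (cong (_* xs j) (loopless-sum j)) (*-distribʳ-sum (xs j) (λ r → member r j)))
          (∑-comm λ j r → member r j * xs j)

        sum-adjacent : ∀ i → sum (λ j → adjacent i j * xs j) ≡ loopless i * σ - sum λ r → member r i * W r
        sum-adjacent i = trans
          (sum-cong-≗ λ j → trans (cong (_* xs j) (adjacent-sum i j))
            (solve 4 (λ u v w y → (u :* v :- w) :* y := u :* (v :* y) :+ con -1ℤ :* (w :* y)) refl
              (loopless i) (loopless j) (sum λ r → member r i * member r j) (xs j)))
          (trans (sum-linear (loopless i) (λ j → loopless j * xs j) -1ℤ
            (λ j → (sum λ r → member r i * member r j) * xs j))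
          (trans (cong₂ (λ s t → loopless i * s + -1ℤ * t) sum-loopless
              (trans (sum-cong-≗ λ j → *-distribʳ-sum (xs j) (λ r → member r i * member r j))
              (trans (∑-comm λ j r → member r i * member r j * xs j)
                (sum-cong-≗ λ r → trans (sum-cong-≗ λ j → *-assoc (member r i) (member r j) (xs j))
                  (sym (*-distribˡ-sum (member r i) (λ j → member r j * xs j)))))))
            (solve 2 (λ s t → s :+ con -1ℤ :* t := s :- t) refl (loopless i * σ) (sum λ r → member r i * W r))))

        row : ∀ i → (M ∗ x) (suc i) ≡ b * loopless i * x₀ + c * (loopless i * σ - sum λ r → member r i * W r)
        row i = cong₂ _+_ (cong (_* x₀) (trans (M-sym (suc i) zero) (M₀ i)))
          (trans (sum-cong-≗ λ j → trans (cong (_* xs j) (Mᵢ i j)) (*-assoc c (adjacent i j) (xs j)))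
          (trans (sym (*-distribˡ-sum c (λ j → adjacent i j * xs j))) (cong (c *_) (sum-adjacent i))))

        sum-member : sum (λ i → xs i * sum λ r → member r i * W r) ≡ T
        sum-member = trans (sum-cong-≗ λ i → *-distribˡ-sum (xs i) (λ r → member r i * W r))
          (trans (∑-comm λ i r → xs i * (member r i * W r))
            (sum-cong-≗ λ r → trans
              (sum-cong-≗ λ i → solve 3 (λ u v w → u :* (v :* w) := (v :* u) :* w) refl (xs i) (member r i) (W r))
              (sym (*-distribʳ-sum (W r) (λ i → member r i * xs i)))))

        value : form M x x ≡ (b * x₀ + c * σ) * σ + (- c) * T
        value = trans (cong₂ _+_ (trans (cong (x₀ *_) ℓx≡0) (*-zeroʳ x₀))
            (trans (sum-cong-≗ λ i → trans (cong (xs i *_) (row i))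
              (solve 7 (λ x b l x₀ c σ s → x :* (b :* l :* x₀ :+ c :* (l :* σ :- s))
                  := (b :* x₀ :+ c :* σ) :* (l :* x) :+ (:- c) :* (x :* s)) refl
                (xs i) b (loopless i) x₀ c σ (sum λ r → member r i * W r)))
            (trans (sum-linear (b * x₀ + c * σ) (λ i → loopless i * xs i) (- c) (λ i → xs i * sum λ r → member r i * W r))
              (cong₂ (λ s t → (b * x₀ + c * σ) * s + (- c) * t) sum-loopless sum-member))))
          (+-identityˡ ((b * x₀ + c * σ) * σ + (- c) * T))

        kernel : a * x₀ + b * σ ≡ 0ℤ
        kernel = trans (sym (cong₂ _+_ (cong (_* x₀) M₀₀)
          (trans (sum-cong-≗ λ j → trans (cong (_* xs j) (M₀ j)) (*-assoc b (loopless j) (xs j)))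
          (trans (sym (*-distribˡ-sum b (λ j → loopless j * xs j))) (cong (b *_) sum-loopless))))) ℓx≡0

        scaled : a * - form M x x ≡ a * c * T - (a * c - b * b) * (σ * σ)
        scaled = trans (cong (λ e → a * - e) value)
          -- The kernel relation a x₀ + b σ = 0, multiplied by b σ, eliminates x₀.
          (trans (solve 6 (λ a b c x σ t → a :* :- ((b :* x :+ c :* σ) :* σ :+ (:- c) :* t)
              := (a :* c :* t :- (a :* c :- b :* b) :* (σ :* σ)) :- (a :* x :+ b :* σ) :* (b :* σ)) refl a b c x₀ σ T)
          (trans (cong (λ e → (a * c * T - (a * c - b * b) * (σ * σ)) - e * (b * σ)) kernel)
            (solve 2 (λ u v → u :- con 0ℤ :* v := u) refl (a * c * T - (a * c - b * b) * (σ * σ)) (b * σ))))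

        0≤T : 0ℤ ≤ T
        0≤T = sum-nonneg λ r → square-nonneg (W r)

        -- If ac - b² ≥ 0, Cauchy-Schwarz bounds σ² by p T and `bound` finishes. Otherwise both
        -- terms are already nonnegative.
        0≤scaled : 0ℤ ≤ a * c * T - (a * c - b * b) * (σ * σ)
        0≤scaled with 0ℤ ≤? a * c - b * b
        ... | yes 0≤D = subst (0ℤ ≤_)
          (solve 5 (λ k d p t s → (k :- d :* p) :* t :+ d :* (p :* t :- s) := k :* t :- d :* s) refl
            (a * c) (a * c - b * b) (+ p) T (σ * σ))
          (+-nonneg (*-nonneg bound 0≤T) (*-nonneg 0≤D (cauchySchwarz W)))
        ... | no  0≰D = subst (0ℤ ≤_)
          (solve 4 (λ k d t s → k :* t :+ (:- d) :* s := k :* t :- d :* s) refl (a * c) (a * c - b * b) T (σ * σ))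
          (+-nonneg (*-nonneg (*-nonneg (<⇒≤ 0<a) 0≤c) 0≤T)
            (*-nonneg (neg-mono-≤ (<⇒≤ (≰⇒> 0≰D))) (square-nonneg σ)))

        nonpositive : form M x x ≤ 0ℤ
        nonpositive = neg-cancel-≤ (*-cancel-nonneg 0<a (subst (0ℤ ≤_) (sym scaled) 0≤scaled))

-- Derivatives and Hessians of set functions.

module Derivatives where

  open import Data.Bool.Base using (true; false; if_then_else_)
  open import Data.Fin.Base using (Fin; zero; suc)
  import Data.Fin.Properties as Fin
  open import Data.Fin.Subset using (Subset; inside; outside; _∈_; _∉_; ∣_∣)
  open import Data.Integer.Base hiding (suc; ∣_∣)
  open import Data.Integer.Properties
  open import Data.Integer.Solver using (module +-*-Solver)
  open import Data.Nat.Base as ℕ using (ℕ; zero; suc)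
  import Data.Nat.Properties as ℕ
  open import Data.Vec.Base using (_∷_; lookup; _[_]≔_)
  open import Data.Vec.Properties using (lookup∘updateAt′; []≔-commutes; []=⇒lookup; lookup⇒[]=)
  open import Data.Vec.Functional using (Vector)
  open import Function.Base using (_∘_; id; const)
  open import Relation.Binary.PropositionalEquality
  open import Relation.Nullary.Decidable using (yes; no)
  open import Relation.Nullary.Negation using (contradiction)
  open +-*-Solver using (solve; _:=_; _:+_; _:*_)
  open QuadraticForms

  -- A function h on the subsets of [n] stands for the polynomial ∑ h(S) w₀^(d-|S|) / (d-|S|)! · w^S,
  -- homogeneous of degree d; ∂ zero is the derivative in w₀, which only lowers d.
  SetFunction : ℕ → Set
  SetFunction n = Subset n → ℤ

  ∂ : ∀ {n} → Fin (suc n) → SetFunction n → SetFunction n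
  ∂ zero    h S = h S
  ∂ (suc i) h S = if lookup S i then 0ℤ else h (S [ i ]≔ inside)

  ∇ : ∀ {n} → SetFunction n → SetFunction n
  ∇ h S = sum λ i → ∂ (suc i) h S

  ∇^ : ∀ {n} → ℕ → SetFunction n → SetFunction n
  ∇^ zero    h = h
  ∇^ (suc r) h = ∇^ r (∇ h)

  -- The Hessian of the quadratic form left after differentiating by w^S and then by w₀ down to
  -- degree 2. Its entries are the values of `h` at S, S ∪ {i} and S ∪ {i,j}, with 0 for repeated
  -- indices.
  hessian : ∀ {n} → SetFunction n → Subset n → Matrix (suc n)
  hessian h S i j = ∂ i (∂ j h) S

  NonNeg : ∀ {n} → SetFunction n → Set
  NonNeg h = ∀ S → 0ℤ ≤ h S

  -- For a nonnegative function: the support is closed under taking subsets. Thus if ∂ᵢ h vanishes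
  -- at S, its whole Hessian at S vanishes.
  DownwardSupported : ∀ {n} → SetFunction n → Set
  DownwardSupported h = ∀ S i → h S ≡ 0ℤ → ∂ i h S ≡ 0ℤ

  ∂-∈ : ∀ {n} {S : Subset n} {i} h → i ∈ S → ∂ (suc i) h S ≡ 0ℤ
  ∂-∈ {S = S} {i} h i∈S with lookup S i | []=⇒lookup i∈S
  ... | true | refl = refl

  ∂-∉ : ∀ {n} {S : Subset n} {i} h → i ∉ S → ∂ (suc i) h S ≡ h (S [ i ]≔ inside)
  ∂-∉ {S = S} {i} h i∉S with lookup S i in eq
  ... | true  = contradiction (lookup⇒[]= i S eq) i∉S
  ... | false = refl

  ∉⇒lookup : ∀ {n} {S : Subset n} {i} → i ∉ S → lookup S i ≡ outside
  ∉⇒lookup {S = S} {i} i∉S with lookup S i in eq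
  ... | true  = contradiction (lookup⇒[]= i S eq) i∉S
  ... | false = refl

  ∂-cong : ∀ {n} i {h h′ : SetFunction n} → (∀ S → h S ≡ h′ S) → ∀ S → ∂ i h S ≡ ∂ i h′ S
  ∂-cong zero    e S = e S
  ∂-cong (suc i) e S with lookup S i
  ... | true  = refl
  ... | false = e (S [ i ]≔ inside)

  ∂-nonneg : ∀ {n} i {h : SetFunction n} → NonNeg h → NonNeg (∂ i h)
  ∂-nonneg zero    0≤h S = 0≤h S
  ∂-nonneg (suc i) 0≤h S with lookup S i
  ... | true  = ≤-refl
  ... | false = 0≤h (S [ i ]≔ inside)

  ∂-+ : ∀ {n} i (h : SetFunction n) c h′ S → ∂ i (λ T → h T + c * h′ T) S ≡ ∂ i h S + c * ∂ i h′ S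
  ∂-+ zero    h c h′ S = refl
  ∂-+ (suc i) h c h′ S with lookup S i
  ... | true  = sym (trans (+-identityˡ (c * 0ℤ)) (*-zeroʳ c))
  ... | false = refl

  ∂-sum : ∀ {n p} i (f : Fin p → SetFunction n) S → ∂ i (λ T → sum λ t → f t T) S ≡ sum λ t → ∂ i (f t) S
  ∂-sum {p = p} zero    f S = refl
  ∂-sum {p = p} (suc i) f S with lookup S i
  ... | true  = sym (sum-replicate-zero p)
  ... | false = refl

  ∂-comm : ∀ {n} i j (h : SetFunction n) S → ∂ i (∂ j h) S ≡ ∂ j (∂ i h) S
  ∂-comm zero    j       h S = refl
  ∂-comm (suc i) zero    h S = refl
  ∂-comm (suc i) (suc j) h S with i Fin.≟ j
  ... | yes refl = refl
  ... | no i≢j rewrite lookup∘updateAt′ j i {const inside} (i≢j ∘ sym) S | lookup∘updateAt′ i j {const inside} i≢j S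
                     | []≔-commutes {x = inside} {inside} S i j i≢j with lookup S i | lookup S j
  ...   | true  | true  = refl
  ...   | true  | false = refl
  ...   | false | true  = refl
  ...   | false | false = refl

  ∂-downwardSupported : ∀ {n} {h : SetFunction n} → DownwardSupported h → ∀ k → DownwardSupported (∂ k h)
  ∂-downwardSupported         down zero    S i e = down S i e
  ∂-downwardSupported {h = h} down (suc k) S i e = trans (∂-comm i (suc k) h S) (vanish e)
    where
    vanish : ∂ (suc k) h S ≡ 0ℤ → ∂ (suc k) (∂ i h) S ≡ 0ℤ
    vanish with lookup S k
    ... | true  = id
    ... | false = down (S [ k ]≔ inside) i

  ∇-nonneg : ∀ {n} {h : SetFunction n} → NonNeg h → NonNeg (∇ h)
  ∇-nonneg 0≤h S = sum-nonneg λ i → ∂-nonneg (suc i) 0≤h S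

  ∇-downwardSupported : ∀ {n} {h : SetFunction n} → NonNeg h → DownwardSupported h → DownwardSupported (∇ h)
  ∇-downwardSupported {h = h} 0≤h down S i ∇h≡0 = trans (∂-sum i (λ k → ∂ (suc k) h) S)
    (sum-zero λ k → ∂-downwardSupported down (suc k) S i (sum≡0⇒≡0 (λ k → ∂-nonneg (suc k) 0≤h S) ∇h≡0 k))

  hessian-sym : ∀ {n} (h : SetFunction n) S → Symmetric (hessian h S)
  hessian-sym h S i j = ∂-comm i j h S

  hessian-∂ : ∀ {n} k (h : SetFunction n) S i j → hessian (∂ k h) S i j ≡ ∂ k (∂ i (∂ j h)) S
  hessian-∂ k h S i j = trans (∂-cong i (∂-comm j k h) S) (∂-comm i k (∂ j h) S)

  -- Differentiating by w_k moves the base point from S to S ∪ {k}, and gives the zero matrix when k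
  -- already lies in S.
  hessian-∂-hyperbolic : ∀ {n} {h : SetFunction n} {S} k →
    (lookup S k ≡ outside → Hyperbolic (hessian h (S [ k ]≔ inside))) → Hyperbolic (hessian (∂ (suc k) h) S)
  hessian-∂-hyperbolic {h = h} {S} k hyp = hyperbolic-cong (λ i j → sym (hessian-∂ (suc k) h S i j)) hyp′
    where
    hyp′ : Hyperbolic (λ i j → ∂ (suc k) (∂ i (∂ j h)) S)
    hyp′ with lookup S k
    ... | true  = zero-hyperbolic λ _ _ → refl
    ... | false = hyp refl

  module _ {n} {h : SetFunction n} (0≤h : NonNeg h) (down : DownwardSupported h) (S : Subset n)
           (hyp : Hyperbolic (hessian h S)) (hyp-∂ : ∀ k → Hyperbolic (hessian (∂ (suc k) h) S))
           (N : ℕ) where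

    private
      -- The partial sums of ∂₀ h + N ∑ᵢ ∂ᵢ h. The list `ι` of indices used so far is what the
      -- induction shortens.
      shift : ∀ {p} → (Fin p → Fin n) → SetFunction n
      shift ι T = h T + + N * sum λ t → ∂ (suc (ι t)) h T

      direction : ∀ {p} → (Fin p → Fin n) → Vector ℤ (suc n)
      direction ι = linear 1ℤ (basis zero) (+ N) (λ j → sum λ t → basis (suc (ι t)) j)

      0≤N : 0ℤ ≤ + N
      0≤N = +≤+ ℕ.z≤n

      basis-nonneg : ∀ {m} (k j : Fin m) → 0ℤ ≤ basis k j
      basis-nonneg zero    zero    = +≤+ ℕ.z≤n
      basis-nonneg zero    (suc j) = ≤-refl
      basis-nonneg (suc k) zero    = ≤-refl
      basis-nonneg (suc k) (suc j) = basis-nonneg k j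

      direction-nonneg : ∀ {p} (ι : Fin p → Fin n) j → 0ℤ ≤ direction ι j
      direction-nonneg ι j = +-nonneg (*-nonneg {1ℤ} (+≤+ ℕ.z≤n) (basis-nonneg zero j))
        (*-nonneg 0≤N (sum-nonneg λ t → basis-nonneg (suc (ι t)) j))

      shift-nonneg : ∀ {p} (ι : Fin p → Fin n) → NonNeg (shift ι)
      shift-nonneg ι T = +-nonneg (0≤h T) (*-nonneg 0≤N (sum-nonneg λ t → ∂-nonneg (suc (ι t)) 0≤h T))

      ∂-shift : ∀ {p} (ι : Fin p → Fin n) i T → ∂ i (shift ι) T ≡ ∂ i h T + + N * sum λ t → ∂ i (∂ (suc (ι t)) h) T
      ∂-shift ι i T = trans (∂-+ i h (+ N) (λ T → sum λ t → ∂ (suc (ι t)) h T) T)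
        (cong (λ e → ∂ i h T + + N * e) (∂-sum i (λ t → ∂ (suc (ι t)) h) T))

      hessian-shift : ∀ {p} (ι : Fin p → Fin n) i j →
        hessian (shift ι) S i j ≡ hessian h S i j + + N * sum λ t → hessian (∂ (suc (ι t)) h) S i j
      hessian-shift ι i j = trans (∂-cong i (∂-shift ι j) S)
        (trans (∂-+ i (∂ j h) (+ N) (λ T → sum λ t → ∂ j (∂ (suc (ι t)) h) T) S)
          (cong (λ e → hessian h S i j + + N * e) (∂-sum i (λ t → ∂ j (∂ (suc (ι t)) h)) S)))

      ∗-sum : ∀ {m p} (M : Matrix m) (f : Fin p → Vector ℤ m) i →
        (M ∗ λ j → sum λ t → f t j) i ≡ sum λ t → (M ∗ f t) i
      ∗-sum M f i = trans (sum-cong-≗ λ j → *-distribˡ-sum (M i j) (λ t → f t j)) (∑-comm λ j t → M i j * f t j)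

      -- `shift ι` is the derivative of `h` along `direction ι`, and partial derivatives commute.
      -- This is the shared functional that `hyperbolic-+` asks for.
      hessian-direction : ∀ {p} (ι : Fin p → Fin n) k i →
        (hessian (∂ k h) S ∗ direction ι) i ≡ hessian (shift ι) S i k
      hessian-direction ι k i = trans
        (∗-linear M 1ℤ (basis zero) (+ N) (λ j → sum λ t → basis (suc (ι t)) j) i)
        (trans (cong₂ (λ s t → s + + N * t)
            (trans (*-identityˡ ((M ∗ basis zero) i)) (∗-basis M zero i))
            (trans (∗-sum M (λ t → basis (suc (ι t))) i)
              (sum-cong-≗ λ t → trans (∗-basis M (suc (ι t)) i) (∂-cong i (∂-comm (suc (ι t)) k h) S))))
          (sym (hessian-shift ι i k)))
        where M = hessian (∂ k h) S

      shift-hyperbolic : ∀ {p} (ι : Fin p → Fin n) → Hyperbolic (hessian (shift ι) S)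
      shift-hyperbolic {zero} ι = hyperbolic-cong
        (λ i j → sym (trans (hessian-shift ι i j)
          (trans (cong (λ e → hessian h S i j + e) (*-zeroʳ (+ N))) (+-identityʳ (hessian h S i j))))) hyp
      shift-hyperbolic {suc p} ι = hyperbolic-cong (λ i j → sym (unfold i j)) (add (∂ k h S ≟ 0ℤ))
        where
        k = suc (ι zero)
        ι′ = ι ∘ suc
        unfold : ∀ i j → hessian (shift ι) S i j ≡ (hessian (shift ι′) S +[ + N ] hessian (∂ k h) S) i j
        unfold i j = trans (hessian-shift ι i j)
          (trans (solve 4 (λ a c d e → a :+ c :* (d :+ e) := (a :+ c :* e) :+ c :* d) refl
                    (hessian h S i j) (+ N) (hessian (∂ k h) S i j) (sum λ t → hessian (∂ (suc (ι′ t)) h) S i j))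
            (cong (_+ + N * hessian (∂ k h) S i j) (sym (hessian-shift ι′ i j))))
        add : _ → Hyperbolic (hessian (shift ι′) S +[ + N ] hessian (∂ k h) S)
        -- Downward support makes the entire added Hessian zero.
        add (yes ∂kh≡0) = hyperbolic-cong (λ i j → sym (trans
            (cong (λ e → hessian (shift ι′) S i j + + N * e)
              (∂-downwardSupported (∂-downwardSupported down k) j S i (∂-downwardSupported down k S j ∂kh≡0)))
            (trans (cong (λ e → hessian (shift ι′) S i j + e) (*-zeroʳ (+ N))) (+-identityʳ (hessian (shift ι′) S i j)))))
          (shift-hyperbolic ι′)
        add (no ∂kh≢0) = hyperbolic-+ (hessian-sym (shift ι′) S) (hessian-sym (∂ k h) S)
          (shift-hyperbolic ι′) (hyp-∂ (ι zero)) 0≤N k (direction ι′) (hessian-direction ι′ k)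
          (∂-nonneg k (∂-nonneg k (shift-nonneg ι′)) S)
          (form-nonneg (hessian (∂ k h) S) (λ i j → ∂-nonneg i (∂-nonneg j (∂-nonneg k 0≤h)) S)
            (direction-nonneg ι′) (direction-nonneg ι′))
          -- The shared functional is nonzero at w₀: its value there is ∂ₖ of the partial sum, which
          -- is at least ∂ₖ h > 0.
          {zero} (<-≤-trans (≤∧≢⇒< (∂-nonneg k 0≤h S) (∂kh≢0 ∘ sym))
            (subst₂ _≤_ (+-identityʳ (∂ k h S)) (sym (∂-shift ι′ k S))
              (+-monoʳ-≤ (∂ k h S) (*-nonneg 0≤N (sum-nonneg λ t → ∂-nonneg k (∂-nonneg (suc (ι′ t)) 0≤h) S)))))

    -- The derivatives ∂ᵢ h are added one at a time to h = ∂₀ h. Starting from w₀ keeps the two forms linked at each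
    -- step: the common functional ∂ᵢ∂₀ h = ∂ᵢ h vanishes only if ∂ᵢ h contributes nothing.
    hessian-+∇-hyperbolic : Hyperbolic (hessian h S +[ + N ] hessian (∇ h) S)
    hessian-+∇-hyperbolic = hyperbolic-cong
      (λ i j → trans (∂-cong i (∂-+ j h (+ N) (∇ h)) S) (∂-+ i (∂ j h) (+ N) (∂ j (∇ h)) S))
      (shift-hyperbolic id)

  ∣S[i]≔inside∣ : ∀ {n} (S : Subset n) i → lookup S i ≡ outside → ∣ S [ i ]≔ inside ∣ ≡ suc ∣ S ∣
  ∣S[i]≔inside∣ (outside ∷ S) zero    _ = refl
  ∣S[i]≔inside∣ (outside ∷ S) (suc i) e = ∣S[i]≔inside∣ S i e
  ∣S[i]≔inside∣ (inside  ∷ S) (suc i) e = cong suc (∣S[i]≔inside∣ S i e)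

  -- Each `∇` costs one element: the Hessian of ∇ h at S is controlled by those of h at S and at the
  -- sets S ∪ {k}. The limit then discards the copy of h that was carried along.
  ∇^-hyperbolic : ∀ {n} r {h : SetFunction n} → NonNeg h → DownwardSupported h →
    (∀ S → ∣ S ∣ ℕ.≤ r → Hyperbolic (hessian h S)) → ∀ S → ∣ S ∣ ≡ 0 → Hyperbolic (hessian (∇^ r h) S)
  ∇^-hyperbolic zero    0≤h down hyp S ∣S∣≡0 = hyp S (ℕ.≤-reflexive ∣S∣≡0)
  ∇^-hyperbolic (suc r) 0≤h down hyp = ∇^-hyperbolic r (∇-nonneg 0≤h) (∇-downwardSupported 0≤h down)
    λ S ∣S∣≤r → hyperbolic-limit {M = hessian _ S} (hessian-+∇-hyperbolic 0≤h down S (hyp S (ℕ.m≤n⇒m≤1+n ∣S∣≤r))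
      λ k → hessian-∂-hyperbolic {S = S} k λ k∉S →
        hyp _ (ℕ.≤-trans (ℕ.≤-reflexive (∣S[i]≔inside∣ S k k∉S)) (ℕ.s≤s ∣S∣≤r)))

-- Sums over all subsets of one size, and their log-concavity.

module Levels where

  open import Data.Bool.Base using (true; false; if_then_else_)
  open import Data.Fin.Base using (zero; suc)
  open import Data.Fin.Subset using (Subset; inside; outside; ⊥; ∣_∣)
  open import Data.Fin.Subset.Properties using (∣⊥∣≡0)
  open import Data.Integer.Base hiding (suc; ∣_∣)
  open import Data.Integer.Properties
  open import Data.Integer.Solver using (module +-*-Solver)
  open import Data.List.Base using ([]; _∷_; map; filter; length)
  open import Data.List.Properties using (filter-++; length-++; filter-≐; filter-none)
  open import Data.List.Relation.Unary.All using (universal)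
  open import Data.Nat.Base as ℕ using (ℕ; zero; suc; _!)
  import Data.Nat.Properties as ℕ
  open import Data.Product.Base using (_,_; map₁)
  open import Data.Vec.Base using ([]; _∷_)
  open import Data.Vec.Functional using (Vector)
  open import Function.Base using (_∘_)
  open import Relation.Binary.PropositionalEquality
  open import Relation.Nullary.Decidable using (Dec; yes; no; does; dec-true; dec-false; _×-dec_)
  open import Relation.Nullary.Negation using (¬_)
  open import Relation.Unary using (Pred; Decidable)
  open +-*-Solver using (solve; _:=_; _:+_; _:*_; con)
  open QuadraticForms
  open Derivatives

  -- The sum of `g` over the subsets of size s, by the same recursion on the first element as
  -- `subsets`.
  level : ∀ {n} → ℕ → SetFunction n → ℤ
  level {zero}  zero    g = g []
  level {zero}  (suc s) g = 0ℤ
  level {suc n} zero    g = level zero (g ∘ (outside ∷_))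
  level {suc n} (suc s) g = level (suc s) (g ∘ (outside ∷_)) + level s (g ∘ (inside ∷_))

  level-cong : ∀ {n} s {g g′ : SetFunction n} → (∀ S → g S ≡ g′ S) → level s g ≡ level s g′
  level-cong {zero}  zero    e = e []
  level-cong {zero}  (suc s) e = refl
  level-cong {suc n} zero    e = level-cong zero (e ∘ (outside ∷_))
  level-cong {suc n} (suc s) e = cong₂ _+_ (level-cong (suc s) (e ∘ (outside ∷_))) (level-cong s (e ∘ (inside ∷_)))

  level-+ : ∀ {n} s (g g′ : SetFunction n) → level s (λ S → g S + g′ S) ≡ level s g + level s g′
  level-+ {zero}  zero    g g′ = refl
  level-+ {zero}  (suc s) g g′ = refl
  level-+ {suc n} zero    g g′ = level-+ zero (g ∘ (outside ∷_)) (g′ ∘ (outside ∷_))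
  level-+ {suc n} (suc s) g g′ = trans
    (cong₂ _+_ (level-+ (suc s) (g ∘ (outside ∷_)) (g′ ∘ (outside ∷_)))
               (level-+ s (g ∘ (inside ∷_)) (g′ ∘ (inside ∷_))))
    (solve 4 (λ a b c d → (a :+ b) :+ (c :+ d) := (a :+ c) :+ (b :+ d)) refl
      (level (suc s) (g ∘ (outside ∷_))) (level (suc s) (g′ ∘ (outside ∷_)))
      (level s (g ∘ (inside ∷_))) (level s (g′ ∘ (inside ∷_))))

  level-weight : ∀ {n} s (w : ℕ → ℤ) (g : SetFunction n) → level s (λ S → w ∣ S ∣ * g S) ≡ w s * level s g
  level-weight {zero}  zero    w g = refl
  level-weight {zero}  (suc s) w g = sym (*-zeroʳ (w (suc s)))
  level-weight {suc n} zero    w g = level-weight zero w (g ∘ (outside ∷_))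
  level-weight {suc n} (suc s) w g = trans
    (cong₂ _+_ (level-weight (suc s) w (g ∘ (outside ∷_))) (level-weight s (w ∘ suc) (g ∘ (inside ∷_))))
    (sym (*-distribˡ-+ (w (suc s)) (level (suc s) (g ∘ (outside ∷_))) (level s (g ∘ (inside ∷_)))))

  -- Each (s+1)-set arises in s+1 ways by adding an element to an s-set.
  level-∇ : ∀ {n} s (g : SetFunction n) → level s (∇ g) ≡ + suc s * level (suc s) g
  level-∇ {zero}  zero    g = refl
  level-∇ {zero}  (suc s) g = sym (*-zeroʳ (+ suc (suc s)))
  level-∇ {suc n} zero    g = trans (level-+ zero (g ∘ (inside ∷_)) (∇ (g ∘ (outside ∷_))))
    (trans (cong (λ e → level zero (g ∘ (inside ∷_)) + e) (level-∇ zero (g ∘ (outside ∷_))))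
      (solve 2 (λ a b → a :+ con 1ℤ :* b := con 1ℤ :* (b :+ a)) refl
        (level zero (g ∘ (inside ∷_))) (level 1 (g ∘ (outside ∷_)))))
  level-∇ {suc n} (suc s) g = trans
    (cong₂ _+_
      (trans (level-+ (suc s) (g ∘ (inside ∷_)) (∇ (g ∘ (outside ∷_))))
        (cong (λ e → level (suc s) (g ∘ (inside ∷_)) + e) (level-∇ (suc s) (g ∘ (outside ∷_)))))
      (trans (level-cong s (λ S → +-identityˡ (∇ (g ∘ (inside ∷_)) S))) (level-∇ s (g ∘ (inside ∷_)))))
    (solve 3 (λ a b m → (a :+ (con 1ℤ :+ m) :* b) :+ m :* a := (con 1ℤ :+ m) :* (b :+ a)) refl
      (level (suc s) (g ∘ (inside ∷_))) (level (suc (suc s)) (g ∘ (outside ∷_))) (+ suc s))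

  -- Every r-set is reached from the empty set in r! orders.
  ∇^-empty : ∀ {n} r (g : SetFunction n) → ∇^ r g ⊥ ≡ + (r !) * level r g
  ∇^-empty zero    g = sym (trans (*-identityˡ (level 0 g)) (level-zero g))
    where
    level-zero : ∀ {n} (g : SetFunction n) → level 0 g ≡ g ⊥
    level-zero {zero}  g = refl
    level-zero {suc n} g = level-zero (g ∘ (outside ∷_))
  ∇^-empty (suc r) g = trans (∇^-empty r (∇ g)) (trans (cong (+ (r !) *_) (level-∇ r g))
    (trans (solve 3 (λ a b c → a :* (b :* c) := (b :* a) :* c) refl (+ (r !)) (+ suc r) (level (suc r) g))
      (cong (_* level (suc r) g) (sym (pos-* (suc r) (r !))))))

  ∇-∇^ : ∀ {n} r (g : SetFunction n) S → ∇ (∇^ r g) S ≡ ∇^ (suc r) g S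
  ∇-∇^ zero    g S = refl
  ∇-∇^ (suc r) g S = ∇-∇^ r (∇ g) S

  ∇-cong : ∀ {n} {h h′ : SetFunction n} → (∀ S → h S ≡ h′ S) → ∀ S → ∇ h S ≡ ∇ h′ S
  ∇-cong e S = sum-cong-≗ λ i → ∂-cong (suc i) e S

  level-nonneg : ∀ {n} s {g : SetFunction n} → NonNeg g → 0ℤ ≤ level s g
  level-nonneg {zero}  zero    0≤g = 0≤g []
  level-nonneg {zero}  (suc s) 0≤g = ≤-refl
  level-nonneg {suc n} zero    0≤g = level-nonneg zero (0≤g ∘ (outside ∷_))
  level-nonneg {suc n} (suc s) 0≤g =
    +-nonneg (level-nonneg (suc s) (0≤g ∘ (outside ∷_))) (level-nonneg s (0≤g ∘ (inside ∷_)))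

  -- The Hessian of ∇^ r g at the empty set, evaluated on w₀ and w₁ + ⋯ + wₙ.
  level-logConcave : ∀ {n} r {g : SetFunction n} → NonNeg g → DownwardSupported g →
    (∀ S → ∣ S ∣ ℕ.≤ r → Hyperbolic (hessian g S)) →
    (+ (r !) * level r g) * (+ (suc (suc r) !) * level (suc (suc r)) g) ≤
    (+ (suc r !) * level (suc r) g) * (+ (suc r !) * level (suc r) g)
  level-logConcave {n} r {g} 0≤g down hyp = subst₂ _≤_ (cong₂ _*_ ee oo) (cong₂ _*_ eo eo)
    (reverseCS (form M e e ≟ 0ℤ))
    where
    h = ∇^ r g
    M = hessian h ⊥
    e o : Vector ℤ (suc n)
    e = basis zero
    o zero    = 0ℤ
    o (suc _) = 1ℤ
    M∗o : ∀ i → (M ∗ o) i ≡ ∂ i (∇ h) ⊥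
    M∗o i = trans (cong₂ _+_ (*-zeroʳ (M i zero)) (sum-cong-≗ λ j → *-identityʳ (M i (suc j))))
      (trans (+-identityˡ _) (sym (∂-sum i (λ j → ∂ (suc j) h) ⊥)))
    ee : form M e e ≡ + (r !) * level r g
    ee = trans (form-basisˡ M zero e) (trans (∗-basis M zero zero) (∇^-empty r g))
    eo : form M e o ≡ + (suc r !) * level (suc r) g
    eo = trans (form-basisˡ M zero o) (trans (M∗o zero) (trans (∇-∇^ r g ⊥) (∇^-empty (suc r) g)))
    oo : form M o o ≡ + (suc (suc r) !) * level (suc (suc r)) g
    oo = trans (cong₂ _+_ (*-zeroˡ ((M ∗ o) zero))
        (sum-cong-≗ λ i → trans (*-identityˡ ((M ∗ o) (suc i))) (M∗o (suc i))))
      (trans (+-identityˡ (∇ (∇ h) ⊥)) (trans (∇-cong (∇-∇^ r g) ⊥)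
        (trans (∇-∇^ (suc r) g ⊥) (∇^-empty (suc (suc r)) g))))
    -- Reverse Cauchy-Schwarz presupposes a positive value at w₀; when that value is 0 the left side
    -- vanishes.
    reverseCS : _ → form M e e * form M o o ≤ form M e o * form M e o
    reverseCS (yes ee≡0) = subst (_≤ form M e o * form M e o)
      (sym (trans (cong (_* form M o o) ee≡0) (*-zeroˡ (form M o o)))) (square-nonneg (form M e o))
    reverseCS (no ee≢0) = Hyperbolic.reverseCauchySchwarz (∇^-hyperbolic r 0≤g down hyp ⊥ (∣⊥∣≡0 n)) e o
      (≤∧≢⇒< (subst (0ℤ ≤_) (sym ee) (*-nonneg {+ (r !)} (+≤+ ℕ.z≤n) (level-nonneg r 0≤g))) (ee≢0 ∘ sym))

  ⟦_⟧ : ∀ {a} {A : Set a} → Dec A → ℤ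
  ⟦ A? ⟧ = if does A? then 1ℤ else 0ℤ

  ⟦⟧-true : ∀ {a} {A : Set a} (A? : Dec A) → A → ⟦ A? ⟧ ≡ 1ℤ
  ⟦⟧-true A? a = cong (λ b → if b then 1ℤ else 0ℤ) (dec-true A? a)

  ⟦⟧-false : ∀ {a} {A : Set a} (A? : Dec A) → ¬ A → ⟦ A? ⟧ ≡ 0ℤ
  ⟦⟧-false A? ¬a = cong (λ b → if b then 1ℤ else 0ℤ) (dec-false A? ¬a)

  ⟦⟧-nonneg : ∀ {a} {A : Set a} (A? : Dec A) → 0ℤ ≤ ⟦ A? ⟧
  ⟦⟧-nonneg A? with does A?
  ... | true  = +≤+ ℕ.z≤n
  ... | false = ≤-refl

  ⟦⟧-cong : ∀ {a b} {A : Set a} {B : Set b} (A? : Dec A) (B? : Dec B) → (A → B) → (B → A) → ⟦ A? ⟧ ≡ ⟦ B? ⟧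
  ⟦⟧-cong A? (yes b) f g = ⟦⟧-true A? (g b)
  ⟦⟧-cong A? (no ¬b) f g = ⟦⟧-false A? (¬b ∘ f)

  indicator : ∀ {p n} {P : Pred (Subset n) p} → Decidable P → SetFunction n
  indicator P? S = ⟦ P? S ⟧

  length-filter-map : ∀ {a b p} {A : Set a} {B : Set b} {P : Pred B p} (P? : Decidable P) (f : A → B) xs →
    length (filter P? (map f xs)) ≡ length (filter (P? ∘ f) xs)
  length-filter-map P? f []       = refl
  length-filter-map P? f (x ∷ xs) with does (P? (f x))
  ... | true  = cong suc (length-filter-map P? f xs)
  ... | false = length-filter-map P? f xs

  length-filter-subsets : ∀ {p n} {P : Pred (Subset n) p} (P? : Decidable P) j →
    + length (filter (λ S → (∣ S ∣ ℕ.≟ j) ×-dec P? S) (subsets n)) ≡ level j (indicator P?)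
  length-filter-subsets {n = zero} P? zero with P? []
  ... | yes _ = refl
  ... | no  _ = refl
  length-filter-subsets {n = zero} P? (suc j) = refl
  length-filter-subsets {n = suc n} P? j = trans
    (cong (+_ ∘ length) (filter-++ (Q? j) (map (outside ∷_) (subsets n)) (map (inside ∷_) (subsets n))))
    (trans (cong +_ (length-++ (filter (Q? j) (map (outside ∷_) (subsets n)))))
    (trans (cong +_ (cong₂ ℕ._+_ (length-filter-map (Q? j) (outside ∷_) (subsets n))
                                 (length-filter-map (Q? j) (inside ∷_) (subsets n))))
      (split j)))
    where
    Q? = λ j S → (∣ S ∣ ℕ.≟ j) ×-dec P? S
    split : ∀ j → + (length (filter (Q? j ∘ (outside ∷_)) (subsets n)) ℕ.+
                     length (filter (Q? j ∘ (inside ∷_)) (subsets n)))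
                  ≡ level j (indicator P?)
    split zero = trans
      (cong (λ l → + (length (filter (Q? zero ∘ (outside ∷_)) (subsets n)) ℕ.+ length l))
        (filter-none (Q? zero ∘ (inside ∷_)) (universal (λ _ ()) (subsets n))))
      (trans (cong +_ (ℕ.+-identityʳ (length (filter (Q? zero ∘ (outside ∷_)) (subsets n)))))
        (length-filter-subsets (P? ∘ (outside ∷_)) zero))
    split (suc j) = cong₂ _+_ (length-filter-subsets (P? ∘ (outside ∷_)) (suc j))
      (trans (cong (+_ ∘ length) (filter-≐ (Q? (suc j) ∘ (inside ∷_)) (λ S → (∣ S ∣ ℕ.≟ j) ×-dec P? (inside ∷ S))
          (map₁ ℕ.suc-injective , map₁ (cong suc)) (subsets n)))
        (length-filter-subsets (P? ∘ (inside ∷_)) j))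

-- Parallel classes of an adjacency relation.

module AdjacencyClasses where

  open import Data.Fin.Base using (Fin; zero; suc)
  open import Data.Fin.Properties using (any?)
  open import Data.Integer.Base hiding (suc)
  open import Data.Integer.Properties
  open import Data.Integer.Solver using (module +-*-Solver)
  open import Data.List.Base using (List; []; _∷_; allFin)
  open import Data.List.Membership.Propositional using (_∈_)
  open import Data.List.Membership.Propositional.Properties using (∈-allFin)
  open import Data.List.Relation.Unary.Any using (here; there)
  open import Data.Nat.Base using (ℕ; zero; suc)
  open import Data.Product.Base using (_,_; ∃; proj₁; proj₂)
  open import Function.Base using (_∘_)
  open import Relation.Binary.PropositionalEquality
  open import Relation.Nullary.Decidable using (Dec; yes; no; decidable-stable; ¬?)
  open import Relation.Nullary.Negation using (contradiction; ¬_)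
  open +-*-Solver using (solve; _:=_; _:*_; _:-_; con)
  open QuadraticForms
  open Levels using (⟦_⟧; ⟦⟧-true; ⟦⟧-false; ⟦⟧-cong)

  -- By irreflexivity, symmetry and cotransitivity of adjacency, "not adjacent" is an equivalence relation on the
  -- loopless elements; its classes are the parallel classes.
  module Classes {ℓ n} {Loopless : Fin n → Set ℓ} {Adjacent : Fin n → Fin n → Set ℓ}
    (loopless? : ∀ i → Dec (Loopless i)) (adjacent? : ∀ i j → Dec (Adjacent i j))
    (adjacent⇒loopless : ∀ {i j} → Adjacent i j → Loopless i)
    (adjacent-sym : ∀ {i j} → Adjacent i j → Adjacent j i)
    (adjacent-irrefl : ∀ {i} → ¬ Adjacent i i)
    (adjacent-cotrans : ∀ {i k} → Adjacent i k → ∀ {j} → Loopless j → ¬ Adjacent i j → Adjacent j k) where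

    record Representatives (xs : List (Fin n)) : Set ℓ where
      field
        size        : ℕ
        rep         : Fin size → Fin n
        loopless    : ∀ r → Loopless (rep r)
        distinct    : ∀ {r s} → r ≢ s → Adjacent (rep r) (rep s)
        represented : ∀ {i} → i ∈ xs → Loopless i → ∃ λ r → ¬ Adjacent (rep r) i

    -- Greedy choice: an element becomes a representative only if it is loopless and adjacent to all
    -- those already chosen; otherwise it is a loop or parallel to one of them.
    representatives : ∀ xs → Representatives xs
    representatives [] = record
      { size = 0 ; rep = λ () ; loopless = λ () ; distinct = λ { {()} } ; represented = λ () }
    representatives (x ∷ xs) with loopless? x | any? (λ r → ¬? (adjacent? (Representatives.rep (representatives xs) r) x))
    ... | no  ¬l | _ = record
      { Representatives (representatives xs)
      ; represented = λ { (here refl) l → contradiction l ¬l ; (there i∈xs) l → represented i∈xs l } }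
      where open Representatives (representatives xs) using (represented)
    ... | yes l | yes (r , ¬adj) = record
      { Representatives (representatives xs)
      ; represented = λ { (here refl) _ → r , ¬adj ; (there i∈xs) l → represented i∈xs l } }
      where open Representatives (representatives xs) using (represented)
    ... | yes l | no all-adjacent = record
      { size        = suc size
      ; rep         = rep′
      ; loopless    = λ { zero → l ; (suc r) → loopless r }
      ; distinct    = distinct′
      ; represented = λ { (here refl) _ → zero , adjacent-irrefl
                        ; (there i∈xs) l → suc (proj₁ (represented i∈xs l)) , proj₂ (represented i∈xs l) }
      }
      where
      open Representatives (representatives xs)
      rep′ : Fin (suc size) → Fin n
      rep′ zero    = x
      rep′ (suc r) = rep r
      adj : ∀ r → Adjacent (rep r) x
      adj r = decidable-stable (adjacent? (rep r) x) λ ¬adj → all-adjacent (r , ¬adj)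
      distinct′ : ∀ {r s} → r ≢ s → Adjacent (rep′ r) (rep′ s)
      distinct′ {zero}  {zero}  r≢s = contradiction refl r≢s
      distinct′ {zero}  {suc s} r≢s = adjacent-sym (adj s)
      distinct′ {suc r} {zero}  r≢s = adj r
      distinct′ {suc r} {suc s} r≢s = distinct (r≢s ∘ cong suc)

    open Representatives (representatives (allFin n)) public using (size; rep; loopless; distinct)
    open Representatives (representatives (allFin n)) using (represented)

    private
      class : ∀ {i} → Loopless i → ∃ λ r → ¬ Adjacent (rep r) i
      class {i} = represented (∈-allFin i)

    -- The characteristic function of the r-th parallel class.
    member : Fin size → Fin n → ℤ
    member r i = ⟦ loopless? i ⟧ * (1ℤ - ⟦ adjacent? (rep r) i ⟧)

    private
      member-loop : ∀ {i} r → ¬ Loopless i → member r i ≡ 0ℤ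
      member-loop {i} r ¬l = trans
        (cong (_* (1ℤ - ⟦ adjacent? (rep r) i ⟧)) (⟦⟧-false (loopless? i) ¬l)) (*-zeroˡ (1ℤ - ⟦ adjacent? (rep r) i ⟧))

      member-loopless : ∀ {i} r → Loopless i → member r i ≡ 1ℤ - ⟦ adjacent? (rep r) i ⟧
      member-loopless {i} r l = trans (cong (_* (1ℤ - ⟦ adjacent? (rep r) i ⟧)) (⟦⟧-true (loopless? i) l)) (*-identityˡ _)

      member-class : ∀ {i} (l : Loopless i) → member (proj₁ (class l)) i ≡ 1ℤ
      member-class {i} l = trans (member-loopless r l)
        (cong (λ e → 1ℤ - e) (⟦⟧-false (adjacent? (rep r) i) (proj₂ (class l))))
        where r = proj₁ (class l)

      member-other : ∀ {i} (l : Loopless i) s → s ≢ proj₁ (class l) → member s i ≡ 0ℤ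
      member-other {i} l s s≢r = trans (member-loopless s l) (cong (λ e → 1ℤ - e) (⟦⟧-true (adjacent? (rep s) i)
        (adjacent-sym (adjacent-cotrans (distinct (s≢r ∘ sym)) l (proj₂ (class l))))))

    loopless-sum : ∀ i → ⟦ loopless? i ⟧ ≡ sum λ r → member r i
    loopless-sum i = by-cases (loopless? i)
      where
      by-cases : Dec (Loopless i) → ⟦ loopless? i ⟧ ≡ sum λ r → member r i
      by-cases (yes l) = trans (⟦⟧-true (loopless? i) l)
        (sym (trans (sum-single (proj₁ (class l)) (member-other l)) (member-class l)))
      by-cases (no ¬l) = trans (⟦⟧-false (loopless? i) ¬l) (sym (sum-zero λ r → member-loop r ¬l))

    -- Loopless elements are adjacent exactly when they lie in different classes, and the sum counts
    -- the classes containing both.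
    adjacent-sum : ∀ i j → ⟦ adjacent? i j ⟧ ≡ ⟦ loopless? i ⟧ * ⟦ loopless? j ⟧ - sum λ r → member r i * member r j
    adjacent-sum i j = by-cases (loopless? i) (loopless? j)
      where
      both-zero : ∀ {u v} → ¬ Adjacent i j → u ≡ 0ℤ → v ≡ 0ℤ → ⟦ adjacent? i j ⟧ ≡ u - v
      both-zero ¬adj refl refl = ⟦⟧-false (adjacent? i j) ¬adj
      by-cases : Dec (Loopless i) → Dec (Loopless j) →
        ⟦ adjacent? i j ⟧ ≡ ⟦ loopless? i ⟧ * ⟦ loopless? j ⟧ - sum λ r → member r i * member r j
      by-cases (no ¬l) _ = both-zero (¬l ∘ adjacent⇒loopless)
        (trans (cong (_* ⟦ loopless? j ⟧) (⟦⟧-false (loopless? i) ¬l)) (*-zeroˡ ⟦ loopless? j ⟧))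
        (sum-zero λ r → trans (cong (_* member r j) (member-loop r ¬l)) (*-zeroˡ (member r j)))
      by-cases (yes _) (no ¬l) = both-zero (¬l ∘ adjacent⇒loopless ∘ adjacent-sym)
        (trans (cong (⟦ loopless? i ⟧ *_) (⟦⟧-false (loopless? j) ¬l)) (*-zeroʳ ⟦ loopless? i ⟧))
        (sum-zero λ r → trans (cong (member r i *_) (member-loop r ¬l)) (*-zeroʳ (member r i)))
      -- With r the class of i, cotransitivity lets `rep r` replace i, and only the r-th term of the
      -- sum survives.
      by-cases (yes l) (yes l′) = trans
        (⟦⟧-cong (adjacent? i j) (adjacent? (rep r) j)
          (λ adj → adjacent-cotrans adj (loopless r) (¬adj ∘ adjacent-sym))
          (λ adj → adjacent-cotrans adj l ¬adj))
        (trans (solve 1 (λ e → e := con 1ℤ :* con 1ℤ :- con 1ℤ :* (con 1ℤ :- e)) refl ⟦ adjacent? (rep r) j ⟧)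
        (sym (cong₂ _-_ (cong₂ _*_ (⟦⟧-true (loopless? i) l) (⟦⟧-true (loopless? j) l′))
          (trans (sum-single r λ s s≢r → trans (cong (_* member s j) (member-other l s s≢r)) (*-zeroˡ (member s j)))
            (cong₂ _*_ (member-class l) (member-loopless r l′))))))
        where
        r = proj₁ (class l)
        ¬adj = proj₂ (class l)

-- Contractions of a linear matroid and the number of their parallel classes.

module LinearMatroids where

  import Algebra.Properties.Ring as RingProperties
  import Algebra.Properties.Semiring.Sum as SemiringSum
  open import Algebra.Apartness.Bundles using (HeytingField)
  open import Data.Fin.Base using (Fin; zero; suc; finToFun; funToFin; combine; remQuot)
  open import Data.Fin.Properties using (_≟_; injective⇒≤; combine-remQuot; funToFin-finToFin; finToFun-funToFin)
  open import Data.Fin.Subset using (Subset; inside; outside; _∈_; _∉_; _⊆_; ∣_∣)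
  open import Data.Fin.Subset.Properties using (_∈?_)
  open import Data.Nat.Base as ℕ using (ℕ; zero; suc; _^_)
  open import Data.Product.Base using (_×_; _,_; proj₁; proj₂; uncurry)
  open import Data.Vec.Base as Vec using (_∷_; _[_]≔_)
  open import Data.Vec.Properties
    using ([]≔-updates; []≔-minimal; []≔-commutes; lookup∘updateAt′; []=⇒lookup; lookup⇒[]=)
  open import Data.Vec.Functional using (Vector)
  import Data.Vec.Functional.Relation.Binary.Equality.Setoid as PointwiseEquality
  open import Function.Base using (_∘_; id)
  open import Relation.Binary.PropositionalEquality as ≡ using (_≡_; _≢_; _≗_)
  import Relation.Binary.Reasoning.Setoid as SetoidReasoning
  open import Relation.Nullary.Decidable using (Dec; yes; no; decidable-stable; ¬?; _×-dec_)
  open import Relation.Nullary.Negation using (contradiction; ¬_)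

  module _ {n} {S : Subset n} where

    insert-∋ : ∀ i → i ∈ S [ i ]≔ inside
    insert-∋ i = []≔-updates S i

    insert-⊇ : ∀ i → S ⊆ S [ i ]≔ inside
    insert-⊇ i {l} l∈S with l ≟ i
    ... | yes ≡.refl = insert-∋ i
    ... | no  l≢i    = []≔-minimal S l i l≢i l∈S

    insert-∈⁻ : ∀ i {l} → l ∈ S [ i ]≔ inside → l ≢ i → l ∈ S
    insert-∈⁻ i {l} l∈S+i l≢i = lookup⇒[]= l S (≡.trans (≡.sym (lookup∘updateAt′ l i l≢i S)) ([]=⇒lookup l∈S+i))

    insert-mono : ∀ i {T} → S ⊆ T → S [ i ]≔ inside ⊆ T [ i ]≔ inside
    insert-mono i {T} S⊆T {l} l∈S+i with l ≟ i
    ... | yes ≡.refl = []≔-updates T i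
    ... | no  l≢i    = []≔-minimal T l i l≢i (S⊆T (insert-∈⁻ i l∈S+i l≢i))

  funToFin-cong : ∀ {m n} {f g : Fin m → Fin n} → f ≗ g → funToFin f ≡ funToFin g
  funToFin-cong {zero}  e = ≡.refl
  funToFin-cong {suc m} e = ≡.cong₂ combine (e zero) (funToFin-cong (e ∘ suc))

  finToFun-injective : ∀ m n {x y : Fin (m ^ n)} → finToFun {m} {n} x ≗ finToFun {m} {n} y → x ≡ y
  finToFun-injective m n {x} {y} e = ≡.trans (≡.sym (funToFin-finToFin {n} {m} x))
    (≡.trans (funToFin-cong {n} {m} {finToFun x} {finToFun y} e) (funToFin-finToFin {n} {m} y))

  module LinearMatroid {c ℓ₁ ℓ₂ q} (F : FiniteField c ℓ₁ ℓ₂ q)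
                       {m n : ℕ} (X : Fin n → Vector (FiniteField.Carrier F) m) where

    open FiniteField F hiding (zero)
    open VectorSet F X
    open RingProperties ring using (-0#≈0#; -‿distribˡ-*)
    open SemiringSum semiring using (sum; sum-cong-≋; ∑-distrib-+; *-distribˡ-sum)
    open PointwiseEquality setoid using (_≋_)
    open HeytingField heytingField using (#⇒invertible; invertible⇒#; tight; #-irrefl)
    open SetoidReasoning setoid

    -- In a trivial ring the difference of 0# with itself would be invertible, making 0# apart from
    -- itself.
    1≉0 : ¬ 1# ≈ 0#
    1≉0 1≈0 = #-irrefl {0#} refl (invertible⇒# (1# , zero-ring , zero-ring))
      where
      zero-ring : ∀ {x y} → x ≈ y
      zero-ring {x} {y} = trans (collapse x) (sym (collapse y))
        where
        collapse : ∀ x → x ≈ 0#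
        collapse x = trans (sym (*-identityˡ x)) (trans (*-congʳ 1≈0) (zeroˡ x))

    *-cancel-zero : ∀ {x y} → x * y ≈ 0# → ¬ x ≈ 0# → y ≈ 0#
    *-cancel-zero {x} {y} xy≈0 x≉0 = decidable-stable (y ≈? 0#) λ y≉0 →
      x≉0 (proj₁ (tight x 0#) λ x#0 → y≉0 (divide (#⇒invertible x#0)))
      where
      divide : _ → y ≈ 0#
      divide (z , zx≈1 , _) = begin
        y                ≈⟨ *-identityˡ y ⟨
        1# * y           ≈⟨ *-congʳ zx≈1 ⟨
        z * (x - 0#) * y ≈⟨ *-congʳ (*-congˡ (trans (+-congˡ -0#≈0#) (+-identityʳ x))) ⟩
        z * x * y        ≈⟨ *-assoc z x y ⟩
        z * (x * y)      ≈⟨ *-congˡ xy≈0 ⟩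
        z * 0#           ≈⟨ zeroʳ z ⟩
        0#               ∎

    x-y≈0⇒x≈y : ∀ {x y} → x + - 1# * y ≈ 0# → x ≈ y
    x-y≈0⇒x≈y {x} {y} e = begin
      x                       ≈⟨ +-identityʳ x ⟨
      x + 0#                  ≈⟨ +-congˡ (trans (*-congʳ (-‿inverseˡ 1#)) (zeroˡ y)) ⟨
      x + (- 1# + 1#) * y     ≈⟨ +-congˡ (distribʳ y (- 1#) 1#) ⟩
      x + (- 1# * y + 1# * y) ≈⟨ +-assoc x (- 1# * y) (1# * y) ⟨
      x + - 1# * y + 1# * y   ≈⟨ +-cong e (*-identityˡ y) ⟩
      0# + y                  ≈⟨ +-identityˡ y ⟩
      y                       ∎

    x≈y⇒x-y≈0 : ∀ {x y} → x ≈ y → x + - 1# * y ≈ 0#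
    x≈y⇒x-y≈0 {x} {y} e = begin
      x + - 1# * y      ≈⟨ +-congʳ (trans e (sym (*-identityˡ y))) ⟩
      1# * y + - 1# * y ≈⟨ distribʳ y 1# (- 1#) ⟨
      (1# + - 1#) * y   ≈⟨ *-congʳ (-‿inverseʳ 1#) ⟩
      0# * y            ≈⟨ zeroˡ y ⟩
      0#                ∎

    _∙_⊕_∙_ : Carrier → Vector Carrier n → Carrier → Vector Carrier n → Vector Carrier n
    (α ∙ a ⊕ β ∙ b) i = α * a i + β * b i

    combination-linear : ∀ α a β b j → combination (α ∙ a ⊕ β ∙ b) j ≈ α * combination a j + β * combination b j
    combination-linear α a β b j = begin
      sum (λ i → (α * a i + β * b i) * X i j)
        ≈⟨ sum-cong-≋ (λ i → trans (distribʳ (X i j) (α * a i) (β * b i))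
             (+-cong (*-assoc α (a i) (X i j)) (*-assoc β (b i) (X i j)))) ⟩
      sum (λ i → α * (a i * X i j) + β * (b i * X i j))
        ≈⟨ ∑-distrib-+ (λ i → α * (a i * X i j)) (λ i → β * (b i * X i j)) ⟩
      sum (λ i → α * (a i * X i j)) + sum (λ i → β * (b i * X i j))
        ≈⟨ +-cong (*-distribˡ-sum α (λ i → a i * X i j)) (*-distribˡ-sum β (λ i → b i * X i j)) ⟨
      α * combination a j + β * combination b j ∎

    Relation : Vector Carrier n → Set _
    Relation a = ∀ j → combination a j ≈ 0#

    zero-combination : ∀ {α β x y} → x ≈ 0# → y ≈ 0# → α * x + β * y ≈ 0#
    zero-combination {α} {β} x≈0 y≈0 =
      trans (+-cong (trans (*-congˡ x≈0) (zeroʳ α)) (trans (*-congˡ y≈0) (zeroʳ β))) (+-identityˡ 0#)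

    relation-linear : ∀ α {a} β {b} → Relation a → Relation b → Relation (α ∙ a ⊕ β ∙ b)
    relation-linear α {a} β {b} ra rb j = trans (combination-linear α a β b j) (zero-combination (ra j) (rb j))

    supportedOn-⊆ : ∀ {S T a} → S ⊆ T → SupportedOn S a → SupportedOn T a
    supportedOn-⊆ S⊆T supp i i∉T = supp i (i∉T ∘ S⊆T)

    supportedOn-remove : ∀ {S i a} → SupportedOn (S [ i ]≔ inside) a → a i ≈ 0# → SupportedOn S a
    supportedOn-remove {S} {i} supp aᵢ≈0 l l∉S with l ≟ i
    ... | yes ≡.refl = aᵢ≈0
    ... | no  l≢i    = supp l λ l∈S+i → l∉S (insert-∈⁻ i l∈S+i l≢i)

    independent-⊆ : ∀ {S T} → S ⊆ T → Independent T → Independent S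
    independent-⊆ S⊆T ind a supp = ind a (supportedOn-⊆ S⊆T supp)

    -- For independent S: i is an element of the contraction M/S and not a loop there.
    Loopless : Subset n → Fin n → Set _
    Loopless S i = i ∉ S × Independent (S [ i ]≔ inside)

    -- For independent S: {i,j} is independent in M/S. Inserting i before j mirrors the nesting of
    -- the derivatives, and the second condition covers both j ∉ S and j ≠ i.
    Adjacent : Subset n → Fin n → Fin n → Set _
    Adjacent S i j = i ∉ S × j ∉ S [ i ]≔ inside × Independent (S [ i ]≔ inside [ j ]≔ inside)

    loopless? : ∀ S i → Dec (Loopless S i)
    loopless? S i = ¬? (i ∈? S) ×-dec independent? (S [ i ]≔ inside)

    adjacent? : ∀ S i j → Dec (Adjacent S i j)
    adjacent? S i j = ¬? (i ∈? S) ×-dec (¬? (j ∈? (S [ i ]≔ inside)) ×-dec independent? (S [ i ]≔ inside [ j ]≔ inside))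

    module _ {S : Subset n} where

      adjacent-≢ : ∀ {i j} → j ∉ S [ i ]≔ inside → i ≢ j
      adjacent-≢ {i} j∉ ≡.refl = j∉ (insert-∋ i)

      adjacent-irrefl : ∀ {i} → ¬ Adjacent S i i
      adjacent-irrefl (_ , i∉ , _) = adjacent-≢ i∉ ≡.refl

      adjacent⇒loopless : ∀ {i j} → Adjacent S i j → Loopless S i
      adjacent⇒loopless {i} {j} (i∉S , _ , ind) = i∉S , independent-⊆ (insert-⊇ j) ind

      ∉-insert : ∀ {i l} → l ∉ S → l ≢ i → l ∉ S [ i ]≔ inside
      ∉-insert {i} l∉S l≢i l∈ = l∉S (insert-∈⁻ i l∈ l≢i)

      adjacent-sym : ∀ {i j} → Adjacent S i j → Adjacent S j i
      adjacent-sym {i} {j} (i∉S , j∉ , ind) = j∉ ∘ insert-⊇ i , ∉-insert i∉S i≢j ,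
        ≡.subst Independent ([]≔-commutes S i j i≢j) ind
        where i≢j = adjacent-≢ j∉

      -- If a is a relation on S ∪ {i,j} and b one on S ∪ {j,k}, eliminating the coefficient at j leaves a
      -- relation on S ∪ {i,k}.
      adjacent-cotrans : ∀ {i k} → Adjacent S i k → ∀ {j} → Loopless S j → ¬ Adjacent S i j → Adjacent S j k
      adjacent-cotrans {i} {k} ik@(i∉S , k∉S+i , ind-ik) {j} (j∉S , ind-j) ¬ij with j ≟ i | j ≟ k
      ... | yes ≡.refl | _          = ik
      ... | no _       | yes ≡.refl = contradiction ik ¬ij
      ... | no j≢i     | no j≢k     = j∉S , ∉-insert k∉S (j≢k ∘ ≡.sym) , ind-jk
        where
        i≢k : i ≢ k
        i≢k = adjacent-≢ k∉S+i
        k∉S : k ∉ S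
        k∉S = k∉S+i ∘ insert-⊇ i
        ind-jk : Independent (S [ j ]≔ inside [ k ]≔ inside)
        ind-jk b supp-b rel-b with b k ≈? 0#
        ... | yes bₖ≈0 = ind-j b (supportedOn-remove supp-b bₖ≈0) rel-b
        -- A relation b involving k would force S ∪ {i,j} to be independent, against `¬ij`.
        ... | no  bₖ≉0 = contradiction (i∉S , ∉-insert j∉S j≢i , ind-ij) ¬ij
          where
          ind-ij : Independent (S [ i ]≔ inside [ j ]≔ inside)
          ind-ij a supp-a rel-a with a i ≈? 0#
          ... | yes aᵢ≈0 = ind-j a (supportedOn-remove
            (≡.subst (λ T → SupportedOn T a) ([]≔-commutes S i j (j≢i ∘ ≡.sym)) supp-a) aᵢ≈0) rel-a
          ... | no  aᵢ≉0 = ind-i a (supportedOn-remove supp-a aⱼ≈0) rel-a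
            where
            ind-i : Independent (S [ i ]≔ inside)
            ind-i = proj₂ (adjacent⇒loopless ik)
            -- Since d = 0 and a vanishes at k, the entry at k gives a_j b_k = 0. Hence a_j = 0, and
            -- a is a relation on S ∪ {i}.
            d = b j ∙ a ⊕ (- a j) ∙ b
            supp-d : SupportedOn (S [ i ]≔ inside [ k ]≔ inside) d
            supp-d l l∉ with l ≟ j
            ... | yes ≡.refl = begin
              b j * a j + - a j * b j   ≈⟨ +-cong (*-comm (b j) (a j)) (sym (-‿distribˡ-* (a j) (b j))) ⟩
              a j * b j + - (a j * b j) ≈⟨ -‿inverseʳ (a j * b j) ⟩
              0#                        ∎
            ... | no  l≢j    = zero-combination
              (supp-a l λ l∈ → l∉ (insert-⊇ k (insert-∈⁻ j l∈ l≢j)))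
              (supp-b l λ l∈ → l∉ (insert-mono k (insert-⊇ i) (drop l∈)))
              where
              drop : l ∈ S [ j ]≔ inside [ k ]≔ inside → l ∈ S [ k ]≔ inside
              drop l∈ = insert-∈⁻ j (≡.subst (l ∈_) ([]≔-commutes S j k j≢k) l∈) l≢j
            d≈0 : ∀ l → d l ≈ 0#
            d≈0 = ind-ik d supp-d (relation-linear (b j) (- a j) rel-a rel-b)
            bᵢ≈0 : b i ≈ 0#
            bᵢ≈0 = supp-b i λ i∈ → i∉S (insert-∈⁻ j (insert-∈⁻ k i∈ i≢k) (j≢i ∘ ≡.sym))
            aₖ≈0 : a k ≈ 0#
            aₖ≈0 = supp-a k λ k∈ → k∉S (insert-∈⁻ i (insert-∈⁻ j k∈ (j≢k ∘ ≡.sym)) (i≢k ∘ ≡.sym))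
            bⱼ≈0 : b j ≈ 0#
            bⱼ≈0 = *-cancel-zero (begin
              a i * b j                 ≈⟨ *-comm (a i) (b j) ⟩
              b j * a i                 ≈⟨ +-identityʳ (b j * a i) ⟨
              b j * a i + 0#            ≈⟨ +-congˡ (trans (*-congˡ bᵢ≈0) (zeroʳ (- a j))) ⟨
              b j * a i + - a j * b i   ≈⟨ d≈0 i ⟩
              0#                        ∎) aᵢ≉0
            -aⱼ≈0 : - a j ≈ 0#
            -aⱼ≈0 = *-cancel-zero (begin
              b k * - a j               ≈⟨ *-comm (b k) (- a j) ⟩
              - a j * b k               ≈⟨ +-identityˡ (- a j * b k) ⟨
              0# + - a j * b k          ≈⟨ +-congʳ (trans (*-congˡ aₖ≈0) (zeroʳ (b j))) ⟨
              b j * a k + - a j * b k   ≈⟨ d≈0 k ⟩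
              0#                        ∎) bₖ≉0
            aⱼ≈0 : a j ≈ 0#
            aⱼ≈0 = begin
              a j              ≈⟨ +-identityʳ (a j) ⟨
              a j + 0#         ≈⟨ +-congˡ -aⱼ≈0 ⟨
              a j + - a j      ≈⟨ -‿inverseʳ (a j) ⟩
              0#               ∎

    combination-injective : ∀ {T} → Independent T → ∀ {u v} → SupportedOn T u → SupportedOn T v →
      combination u ≋ combination v → u ≋ v
    combination-injective ind {u} {v} supp-u supp-v e i = x-y≈0⇒x≈y (trans (+-congʳ (sym (*-identityˡ (u i))))
      (ind (1# ∙ u ⊕ (- 1#) ∙ v) (λ l l∉ → zero-combination (supp-u l l∉) (supp-v l l∉))
        (λ j → trans (combination-linear 1# u (- 1#) v j)
          (trans (+-congʳ (*-identityˡ (combination u j))) (x≈y⇒x-y≈0 (e j)))) i))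

    -- Extension by zero, which identifies F^|S| with the coefficient vectors supported on S.
    spread : ∀ {n} (S : Subset n) → Vector Carrier ∣ S ∣ → Vector Carrier n
    spread (outside ∷ S) a zero    = 0#
    spread (outside ∷ S) a (suc i) = spread S a i
    spread (inside  ∷ S) a zero    = a zero
    spread (inside  ∷ S) a (suc i) = spread S (a ∘ suc) i

    spread-outside : ∀ {n} (S : Subset n) a i → i ∉ S → spread S a i ≈ 0#
    spread-outside (outside ∷ S) a zero    i∉S = refl
    spread-outside (outside ∷ S) a (suc i) i∉S = spread-outside S a i (i∉S ∘ Vec.there)
    spread-outside (inside  ∷ S) a zero    i∉S = contradiction Vec.here i∉S
    spread-outside (inside  ∷ S) a (suc i) i∉S = spread-outside S (a ∘ suc) i (i∉S ∘ Vec.there)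

    spread-injective : ∀ {n} (S : Subset n) {a b} → spread S a ≋ spread S b → a ≋ b
    spread-injective (outside ∷ S) e i       = spread-injective S (e ∘ suc) i
    spread-injective (inside  ∷ S) e zero    = e zero
    spread-injective (inside  ∷ S) e (suc i) = spread-injective S (e ∘ suc) i

    unit : Fin n → Vector Carrier n
    unit i l with l ≟ i
    ... | yes _ = 1#
    ... | no  _ = 0#

    unit-on : ∀ i → unit i i ≈ 1#
    unit-on i with i ≟ i
    ... | yes _  = refl
    ... | no i≢i = contradiction ≡.refl i≢i

    unit-off : ∀ {i l} → l ≢ i → unit i l ≈ 0#
    unit-off {i} {l} l≢i with l ≟ i
    ... | yes l≡i = contradiction l≡i l≢i
    ... | no _    = refl

    -- The cosets of the span of S containing 0 and the representatives are disjoint, and each has q^|S| elements.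
    module Cosets {S : Subset n} (indep : Independent S) {p} (rep : Fin p → Fin n)
      (loopless : ∀ r → Loopless S (rep r)) (distinct : ∀ {r s} → r ≢ s → Adjacent S (rep r) (rep s)) where

      offset : Fin (suc p) → Vector Carrier n
      offset zero    l = 0#
      offset (suc r) l = unit (rep r) l

      -- Points of the cosets are kept as coefficient vectors, so that independence can tell their
      -- combinations apart. Index 0 is the span of S itself.
      point : Fin (suc p) → Vector Carrier ∣ S ∣ → Vector Carrier n
      point t a l = spread S a l + offset t l

      point-supported : ∀ {T} t a → S ⊆ T → (∀ r → t ≡ suc r → rep r ∈ T) → SupportedOn T (point t a)
      point-supported zero a S⊆T _ l l∉T =
        trans (+-congʳ (spread-outside S a l (l∉T ∘ S⊆T))) (+-identityˡ 0#)
      point-supported {T} (suc r) a S⊆T rep∈T l l∉T =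
        trans (+-cong (spread-outside S a l (l∉T ∘ S⊆T)) (unit-off λ l≡ →
            l∉T (≡.subst (_∈ T) (≡.sym l≡) (rep∈T r ≡.refl))))
          (+-identityˡ 0#)

      spread-cancel : ∀ {t a b} → point t a ≋ point t b → a ≋ b
      spread-cancel {t} {a} {b} e = spread-injective S λ l → begin
        spread S a l                               ≈⟨ undo (spread S a l) (offset t l) ⟨
        point t a l + - offset t l                 ≈⟨ +-congʳ (e l) ⟩
        point t b l + - offset t l                 ≈⟨ undo (spread S b l) (offset t l) ⟩
        spread S b l                               ∎
        where
        undo : ∀ x y → x + y + - y ≈ x
        undo x y = trans (+-assoc x y (- y)) (trans (+-congˡ (-‿inverseʳ y)) (+-identityʳ x))

      -- The coefficients at `rep r`, which lies outside S, are 1 and 0.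
      offset-differ : ∀ {t u r a b} → t ≡ suc r → offset u (rep r) ≈ 0# → ¬ point t a ≋ point u b
      offset-differ {u = u} {r} {a} {b} ≡.refl u≈0 e = 1≉0 (begin
        1#                                    ≈⟨ +-identityˡ 1# ⟨
        0# + 1#                               ≈⟨ +-cong (spread-outside S a (rep r) (proj₁ (loopless r)))
                                                       (unit-on (rep r)) ⟨
        point (suc r) a (rep r)               ≈⟨ e (rep r) ⟩
        spread S b (rep r) + offset u (rep r) ≈⟨ +-cong (spread-outside S b (rep r) (proj₁ (loopless r))) u≈0 ⟩
        0# + 0#                               ≈⟨ +-identityˡ 0# ⟩
        0#                                    ∎)

      -- Both coefficient vectors are supported on S together with at most two representatives. That
      -- set is independent, so equal combinations have equal coefficients.
      point-injective : ∀ t u {a b} → combination (point t a) ≋ combination (point u b) → t ≡ u × a ≋ b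
      point-injective zero zero {a} {b} e = ≡.refl , spread-cancel {zero}
        (combination-injective indep (point-supported zero a id λ _ ()) (point-supported zero b id λ _ ()) e)
      point-injective zero (suc r) {a} {b} e = contradiction
        (λ l → sym (combination-injective (proj₂ (loopless r))
          (point-supported zero a (insert-⊇ (rep r)) λ _ ())
          (point-supported (suc r) b (insert-⊇ (rep r)) λ { _ ≡.refl → insert-∋ (rep r) }) e l))
        (offset-differ {suc r} {zero} ≡.refl refl)
      point-injective (suc r) zero {a} {b} e = contradiction
        (combination-injective (proj₂ (loopless r))
          (point-supported (suc r) a (insert-⊇ (rep r)) λ { _ ≡.refl → insert-∋ (rep r) })
          (point-supported zero b (insert-⊇ (rep r)) λ _ ()) e)
        (offset-differ {suc r} {zero} ≡.refl refl)
      point-injective (suc r) (suc s) {a} {b} e with r ≟ s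
      ... | yes ≡.refl = ≡.refl , spread-cancel {suc r}
        (combination-injective (proj₂ (loopless r)) (supp a) (supp b) e)
        where
        supp : ∀ a → SupportedOn (S [ rep r ]≔ inside) (point (suc r) a)
        supp a = point-supported (suc r) a (insert-⊇ (rep r)) λ { _ ≡.refl → insert-∋ (rep r) }
      ... | no r≢s = contradiction
        (combination-injective (proj₂ (proj₂ adj))
          (point-supported (suc r) a S⊆T λ { _ ≡.refl → insert-⊇ (rep s) (insert-∋ (rep r)) })
          (point-supported (suc s) b S⊆T λ { _ ≡.refl → insert-∋ (rep s) }) e)
        (offset-differ {suc r} {suc s} ≡.refl (unit-off (adjacent-≢ (proj₁ (proj₂ adj)))))
        where
        adj = distinct r≢s
        S⊆T : S ⊆ S [ rep r ]≔ inside [ rep s ]≔ inside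
        S⊆T = insert-⊇ (rep s) ∘ insert-⊇ (rep r)

      cosets-bound : suc p ℕ.* q ^ ∣ S ∣ ℕ.≤ q ^ m
      cosets-bound = injective⇒≤ {f = code} code-injective
        where
        coefficients : Fin (q ^ ∣ S ∣) → Vector Carrier ∣ S ∣
        coefficients y = Enum.to ∘ finToFun y
        value : Fin (suc p) × Fin (q ^ ∣ S ∣) → Vector Carrier m
        value (t , y) = combination (point t (coefficients y))
        code : Fin (suc p ℕ.* q ^ ∣ S ∣) → Fin (q ^ m)
        code x = funToFin (Enum.from ∘ value (remQuot (q ^ ∣ S ∣) x))
        to-injective : ∀ {x y} → Enum.to x ≈ Enum.to y → x ≡ y
        to-injective {x} {y} e = ≡.trans (≡.sym (Enum.strictlyInverseʳ x))
          (≡.trans (Enum.from-cong e) (Enum.strictlyInverseʳ y))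
        from-injective : ∀ {x y} → Enum.from x ≡ Enum.from y → x ≈ y
        from-injective {x} {y} e = trans (sym (Enum.strictlyInverseˡ x))
          (trans (Enum.to-cong e) (Enum.strictlyInverseˡ y))
        value-injective : ∀ tx uy → value tx ≋ value uy → tx ≡ uy
        value-injective (t , x) (u , y) e with point-injective t u e
        ... | t≡u , a≋b = ≡.cong₂ _,_ t≡u (finToFun-injective q ∣ S ∣ (to-injective ∘ a≋b))
        code-injective : ∀ {x y} → code x ≡ code y → x ≡ y
        code-injective {x} {y} e = ≡.trans (≡.sym (combine-remQuot {suc p} (q ^ ∣ S ∣) x))
          (≡.trans (≡.cong (uncurry combine) (value-injective (remQuot (q ^ ∣ S ∣) x) (remQuot (q ^ ∣ S ∣) y) λ j →
            from-injective (≡.trans (≡.sym (finToFun-funToFin (Enum.from ∘ value (remQuot (q ^ ∣ S ∣) x)) j))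
              (≡.trans (≡.cong (λ z → finToFun z j) e)
                (finToFun-funToFin (Enum.from ∘ value (remQuot (q ^ ∣ S ∣) y)) j)))))
          (combine-remQuot {suc p} (q ^ ∣ S ∣) y))

-- Hessians of the weighted independence function, and the resulting inequality.

module UltraLogConcavity where

  open import Data.Bool.Base using (true; false; if_then_else_)
  open import Data.Fin.Base using (Fin; zero; suc)
  open import Data.Fin.Subset using (inside; _∈_; ∣_∣)
  open import Data.Fin.Subset.Properties using (_∈?_)
  open import Data.Integer.Base hiding (suc; ∣_∣; NonZero; _^_)
  open import Data.Integer.Properties
  open import Data.Integer.Solver using (module +-*-Solver)
  open import Data.Nat.Base as ℕ using (ℕ; zero; suc; _∸_; _^_; NonZero; _!)
  import Data.Nat.Properties as ℕ
  open import Data.Product.Base using (_,_; proj₁; proj₂)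
  open import Data.Rational.Base as ℚ using (1ℚ; toℚᵘ)
  import Data.Rational.Properties as ℚ
  open import Data.Rational.Unnormalised.Base as ℚᵘ using (ℚᵘ; mkℚᵘ; 1ℚᵘ; *≤*)
  import Data.Rational.Unnormalised.Properties as ℚᵘ
  open import Data.Sum.Base using (inj₁; inj₂)
  open import Data.Vec.Base using (_[_]≔_)
  open import Data.Vec.Functional using (Vector)
  open import Function.Base using (_∘_)
  open import Relation.Binary.PropositionalEquality
  open import Relation.Nullary.Decidable using (Dec; yes; no; does; dec-true; dec-false)
  open import Relation.Nullary.Negation using (contradiction; ¬_)
  open +-*-Solver using (solve; _:=_; _:+_; _:*_; _:-_; con)
  open QuadraticForms
  open Derivatives
  open Levels
  open AdjacencyClasses
  open LinearMatroids

  toℚᵘ-/ : ∀ i n .{{_ : NonZero n}} → toℚᵘ (i ℚ./ n) ℚᵘ.≃ i ℚᵘ./ n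
  toℚᵘ-/ i (suc n) = ℚ.toℚᵘ-fromℚᵘ (mkℚᵘ i n)

  -- Denominators are cleared through 1 + 1/k = (k+1)/k. The unnormalised rationals serve because
  -- their order is cross-multiplication by definition.
  ℕ⇒ℚ-inequality : ∀ k d .{{_ : NonZero k}} .{{_ : NonZero d}} x y z →
    (+ suc k * + suc d) * (+ x * + z) ≤ (+ k * + d) * (+ y * + y) →
    (1ℚ ℚ.+ 1ℤ ℚ./ k) ℚ.* (1ℚ ℚ.+ 1ℤ ℚ./ d) ℚ.* ℕ→ℚ x ℚ.* ℕ→ℚ z ℚ.≤ ℕ→ℚ y ℚ.* ℕ→ℚ y
  ℕ⇒ℚ-inequality k@(suc k-1) d@(suc d-1) x y z h = ℚ.toℚᵘ-cancel-≤
    (ℚᵘ.≤-respˡ-≃ (ℚᵘ.≃-sym lhs) (ℚᵘ.≤-respʳ-≃ (ℚᵘ.≃-sym rhs) (*≤* (subst₂ _≤_ eq₁ eq₂ h))))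
    where
    nat : ℕ → ℚᵘ
    nat n = + n ℚᵘ./ 1
    factor : ∀ n .{{_ : NonZero n}} → toℚᵘ (1ℚ ℚ.+ 1ℤ ℚ./ n) ℚᵘ.≃ 1ℚᵘ ℚᵘ.+ 1ℤ ℚᵘ./ n
    factor n = ℚᵘ.≃-trans (ℚ.toℚᵘ-homo-+ 1ℚ (1ℤ ℚ./ n)) (ℚᵘ.+-cong (ℚᵘ.≃-refl {1ℚᵘ}) (toℚᵘ-/ 1ℤ n))
    product : ∀ {p q p′ q′} → toℚᵘ p ℚᵘ.≃ p′ → toℚᵘ q ℚᵘ.≃ q′ → toℚᵘ (p ℚ.* q) ℚᵘ.≃ p′ ℚᵘ.* q′
    product {p} {q} e e′ = ℚᵘ.≃-trans (ℚ.toℚᵘ-homo-* p q) (ℚᵘ.*-cong e e′)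
    lhs : toℚᵘ ((1ℚ ℚ.+ 1ℤ ℚ./ k) ℚ.* (1ℚ ℚ.+ 1ℤ ℚ./ d) ℚ.* ℕ→ℚ x ℚ.* ℕ→ℚ z) ℚᵘ.≃
          (1ℚᵘ ℚᵘ.+ 1ℤ ℚᵘ./ k) ℚᵘ.* (1ℚᵘ ℚᵘ.+ 1ℤ ℚᵘ./ d) ℚᵘ.* nat x ℚᵘ.* nat z
    lhs = product {(1ℚ ℚ.+ 1ℤ ℚ./ k) ℚ.* (1ℚ ℚ.+ 1ℤ ℚ./ d) ℚ.* ℕ→ℚ x} {ℕ→ℚ z}
      (product {(1ℚ ℚ.+ 1ℤ ℚ./ k) ℚ.* (1ℚ ℚ.+ 1ℤ ℚ./ d)} {ℕ→ℚ x}
        (product {1ℚ ℚ.+ 1ℤ ℚ./ k} {1ℚ ℚ.+ 1ℤ ℚ./ d} (factor k) (factor d)) (toℚᵘ-/ (+ x) 1))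
      (toℚᵘ-/ (+ z) 1)
    rhs : toℚᵘ (ℕ→ℚ y ℚ.* ℕ→ℚ y) ℚᵘ.≃ nat y ℚᵘ.* nat y
    rhs = product {ℕ→ℚ y} {ℕ→ℚ y} (toℚᵘ-/ (+ y) 1) (toℚᵘ-/ (+ y) 1)
    eq₁ : (+ suc k * + suc d) * (+ x * + z) ≡
          (1ℤ * + k + 1ℤ * 1ℤ) * (1ℤ * + d + 1ℤ * 1ℤ) * + x * + z * 1ℤ
    eq₁ = solve 4 (λ k d x z → ((con 1ℤ :+ k) :* (con 1ℤ :+ d)) :* (x :* z) :=
        (con 1ℤ :* k :+ con 1ℤ :* con 1ℤ) :* (con 1ℤ :* d :+ con 1ℤ :* con 1ℤ) :* x :* z :* con 1ℤ) refl
      (+ k) (+ d) (+ x) (+ z)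
    eq₂ : (+ k * + d) * (+ y * + y) ≡ + y * + y * ((+ 1 * + k) * (+ 1 * + d) * + 1 * + 1)
    eq₂ = solve 3 (λ k d y → (k :* d) :* (y :* y) := y :* y :* ((con 1ℤ :* k) :* (con 1ℤ :* d) :* con 1ℤ :* con 1ℤ)) refl
      (+ k) (+ d) (+ y)

  -- Here r = k - 1 and d = q^(m-k+1) - 2; the latter is recorded as a sum to avoid truncated
  -- subtraction.
  module UltraLogConcave {c ℓ₁ ℓ₂ q} (F : FiniteField c ℓ₁ ℓ₂ q)
    {m n : ℕ} (X : Fin n → Vector (FiniteField.Carrier F) m)
    (r d : ℕ) .{{_ : NonZero d}} (r<m : suc r ℕ.< m) (2+d≡q^ : 2 ℕ.+ d ≡ q ^ (m ∸ suc r ℕ.+ 1)) where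

    open VectorSet F X
    open LinearMatroid F X

    -- The weights are flat except for one drop, from size r to r + 1, which is as large as the hyperbolicity of the
    -- Hessians at independent sets of size r permits.
    weight : ℕ → ℤ
    weight s = if does (s ℕ.≤? r) then + suc d else + d

    weight-≤ : ∀ {s} → s ℕ.≤ r → weight s ≡ + suc d
    weight-≤ {s} s≤r = cong (λ b → if b then + suc d else + d) (dec-true (s ℕ.≤? r) s≤r)

    weight-> : ∀ {s} → r ℕ.< s → weight s ≡ + d
    weight-> {s} r<s = cong (λ b → if b then + suc d else + d) (dec-false (s ℕ.≤? r) (ℕ.<⇒≱ r<s))

    0<d : 0ℤ < + d
    0<d = +<+ (ℕ.>-nonZero⁻¹ d)

    weight-pos : ∀ s → 0ℤ < weight s
    weight-pos s with does (s ℕ.≤? r)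
    ... | true  = +<+ (ℕ.s≤s ℕ.z≤n)
    ... | false = 0<d

    g : SetFunction n
    g S = weight ∣ S ∣ * indicator independent? S

    g-independent : ∀ {S} → Independent S → g S ≡ weight ∣ S ∣
    g-independent {S} ind = trans (cong (weight ∣ S ∣ *_) (⟦⟧-true (independent? S) ind)) (*-identityʳ (weight ∣ S ∣))

    g-dependent : ∀ {S} → ¬ Independent S → g S ≡ 0ℤ
    g-dependent {S} dep = trans (cong (weight ∣ S ∣ *_) (⟦⟧-false (independent? S) dep)) (*-zeroʳ (weight ∣ S ∣))

    g-nonneg : NonNeg g
    g-nonneg S = *-nonneg (<⇒≤ (weight-pos ∣ S ∣)) (⟦⟧-nonneg (independent? S))

    g-downwardSupported : DownwardSupported g
    g-downwardSupported S zero    gS≡0 = gS≡0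
    g-downwardSupported S (suc i) gS≡0 = by-cases (i ∈? S) (independent? S)
      where
      by-cases : Dec (i ∈ S) → Dec (Independent S) → ∂ (suc i) g S ≡ 0ℤ
      by-cases (yes i∈S) _         = ∂-∈ g i∈S
      by-cases (no _)    (yes ind) = contradiction (trans (sym (g-independent ind)) gS≡0) (≢-sym (<⇒≢ (weight-pos ∣ S ∣)))
      by-cases (no i∉S)  (no dep)  = trans (∂-∉ g i∉S) (g-dependent (dep ∘ independent-⊆ (insert-⊇ i)))

    ∂g : ∀ S i → ∂ (suc i) g S ≡ weight (suc ∣ S ∣) * ⟦ loopless? S i ⟧
    ∂g S i = by-cases (i ∈? S)
      where
      by-cases : Dec (i ∈ S) → ∂ (suc i) g S ≡ weight (suc ∣ S ∣) * ⟦ loopless? S i ⟧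
      by-cases (yes i∈S) = trans (∂-∈ g i∈S) (sym (trans
        (cong (weight (suc ∣ S ∣) *_) (⟦⟧-false (loopless? S i) λ l → proj₁ l i∈S)) (*-zeroʳ (weight (suc ∣ S ∣)))))
      by-cases (no i∉S) = trans (∂-∉ g i∉S) (cong₂ (λ s e → weight s * e) (∣S[i]≔inside∣ S i (∉⇒lookup i∉S))
        (⟦⟧-cong (independent? (S [ i ]≔ inside)) (loopless? S i) (i∉S ,_) proj₂))

    ∂∂g : ∀ S i j → ∂ (suc i) (∂ (suc j) g) S ≡ weight (2 ℕ.+ ∣ S ∣) * ⟦ adjacent? S i j ⟧
    ∂∂g S i j = by-cases (i ∈? S)
      where
      by-cases : Dec (i ∈ S) → ∂ (suc i) (∂ (suc j) g) S ≡ weight (2 ℕ.+ ∣ S ∣) * ⟦ adjacent? S i j ⟧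
      by-cases (yes i∈S) = trans (∂-∈ (∂ (suc j) g) i∈S) (sym (trans
        (cong (weight (2 ℕ.+ ∣ S ∣) *_) (⟦⟧-false (adjacent? S i j) λ a → proj₁ a i∈S)) (*-zeroʳ (weight (2 ℕ.+ ∣ S ∣)))))
      by-cases (no i∉S) = trans (∂-∉ (∂ (suc j) g) i∉S) (trans (∂g (S [ i ]≔ inside) j)
        (cong₂ (λ s e → weight (suc s) * e) (∣S[i]≔inside∣ S i (∉⇒lookup i∉S))
          (⟦⟧-cong (loopless? (S [ i ]≔ inside) j) (adjacent? S i j) (i∉S ,_) proj₂)))

    -- For s < r the first two weights agree and the third is no larger, so ac - b² ≤ 0. For s = r
    -- the weights are d + 1, d, d and the expression is d (d + 1 - p); the coset bound divided by
    -- q^r gives p + 1 ≤ q^(m-r) = d + 2.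
    weight-bound : ∀ {s p} → s ℕ.≤ r → suc p ℕ.* q ^ s ℕ.≤ q ^ m →
      0ℤ ≤ weight s * weight (2 ℕ.+ s) - (weight s * weight (2 ℕ.+ s) - weight (suc s) * weight (suc s)) * + p
    weight-bound {s} {p} s≤r cosets with ℕ.m≤n⇒m<n∨m≡n s≤r
    ... | inj₁ s<r = subst (0ℤ ≤_)
      (trans (solve 3 (λ a c p → a :* c :+ a :* (a :- c) :* p := a :* c :- (a :* c :- a :* a) :* p) refl
          (weight s) (weight (2 ℕ.+ s)) (+ p))
        (cong (λ b → weight s * weight (2 ℕ.+ s) - (weight s * weight (2 ℕ.+ s) - b * b) * + p)
          (trans (weight-≤ s≤r) (sym (weight-≤ s<r)))))
      (+-nonneg (*-nonneg (<⇒≤ (weight-pos s)) (<⇒≤ (weight-pos (2 ℕ.+ s))))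
        (*-nonneg (*-nonneg (<⇒≤ (weight-pos s)) (i≤j⇒0≤j-i (subst (weight (2 ℕ.+ s) ≤_) (sym (weight-≤ s≤r)) weight≤)))
          (+≤+ ℕ.z≤n)))
      where
      weight≤ : weight (2 ℕ.+ s) ≤ + suc d
      weight≤ with does (2 ℕ.+ s ℕ.≤? r)
      ... | true  = ≤-refl
      ... | false = +≤+ (ℕ.n≤1+n d)
    ... | inj₂ refl rewrite weight-≤ {s} s≤r | weight-> {suc s} (ℕ.n<1+n s)
                          | weight-> {2 ℕ.+ s} (ℕ.m≤n⇒m≤1+n (ℕ.n<1+n s)) =
      subst (0ℤ ≤_)
        (solve 2 (λ d p → d :* ((con 1ℤ :+ d) :- p) :=
            (con 1ℤ :+ d) :* d :- ((con 1ℤ :+ d) :* d :- d :* d) :* p) refl (+ d) (+ p))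
        (*-nonneg (<⇒≤ 0<d) (i≤j⇒0≤j-i (+≤+ (ℕ.s≤s⁻¹ 1+p≤2+d))))
      where
      q^m≡ : q ^ m ≡ (2 ℕ.+ d) ℕ.* q ^ s
      q^m≡ = trans (cong (q ^_) m≡) (trans (ℕ.^-distribˡ-+-* q (m ∸ suc s ℕ.+ 1) s) (cong (ℕ._* q ^ s) (sym 2+d≡q^)))
        where
        m≡ : m ≡ m ∸ suc s ℕ.+ 1 ℕ.+ s
        m≡ = trans (sym (ℕ.m∸n+n≡m (ℕ.<⇒≤ r<m))) (sym (ℕ.+-assoc (m ∸ suc s) 1 s))
      q≢0 : NonZero q
      q≢0 = ℕ.≢-nonZero λ { refl → contradiction (trans 2+d≡q^ (cong (0 ^_) (ℕ.+-comm (m ∸ suc s) 1))) λ () }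
      1+p≤2+d : suc p ℕ.≤ 2 ℕ.+ d
      1+p≤2+d = ℕ.*-cancelʳ-≤ (suc p) (2 ℕ.+ d) (q ^ s) {{ℕ.m^n≢0 q s {{q≢0}}}} (subst (suc p ℕ.* q ^ s ℕ.≤_) q^m≡ cosets)

    g-hyperbolic : ∀ S → ∣ S ∣ ℕ.≤ r → Hyperbolic (hessian g S)
    g-hyperbolic S ∣S∣≤r with independent? S
    -- No superset of a dependent set is independent, so the Hessian is zero.
    ... | no  dep = zero-hyperbolic λ i j →
      ∂-downwardSupported g-downwardSupported j S i (g-downwardSupported S j (g-dependent dep))
    ... | yes ind = partition-hyperbolic (hessian-sym g S)
      {weight ∣ S ∣} {weight (suc ∣ S ∣)} {weight (2 ℕ.+ ∣ S ∣)} member (g-independent ind) (∂g S) (∂∂g S)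
      loopless-sum adjacent-sum (weight-pos ∣ S ∣) (<⇒≤ (weight-pos (2 ℕ.+ ∣ S ∣)))
      (weight-bound ∣S∣≤r (Cosets.cosets-bound ind rep loopless distinct))
      where
      open Classes (loopless? S) (adjacent? S) adjacent⇒loopless adjacent-sym adjacent-irrefl adjacent-cotrans

    level-g : ∀ j → level j g ≡ weight j * + I j
    level-g j = trans (level-weight j weight (indicator independent?))
      (cong (weight j *_) (sym (length-filter-subsets independent? j)))

    -- Log-concavity of the weighted level sums carries the positive common factor K = r!² (r+1) d;
    -- cancelling it leaves the ratios (r+2)/(r+1) and (d+1)/d.
    ultraLogConcave : (+ suc (suc r) * + suc d) * (+ I r * + I (suc (suc r))) ≤
                      (+ suc r * + d) * (+ I (suc r) * + I (suc r))
    ultraLogConcave = 0≤i-j⇒j≤i (*-cancel-nonneg 0<K (subst (0ℤ ≤_) factored (i≤j⇒0≤j-i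
        (subst₂ _≤_ (cong₂ _*_ (term r (weight-≤ ℕ.≤-refl)) (term (suc (suc r)) (weight-> (ℕ.m≤n⇒m≤1+n (ℕ.n<1+n r)))))
                    (cong₂ _*_ (term (suc r) (weight-> (ℕ.n<1+n r))) (term (suc r) (weight-> (ℕ.n<1+n r))))
          (level-logConcave r g-nonneg g-downwardSupported g-hyperbolic)))))
      where
      term : ∀ j {w} → weight j ≡ w → + (j !) * level j g ≡ + (j !) * (w * + I j)
      term j e = cong (+ (j !) *_) (trans (level-g j) (cong (_* + I j) e))
      K : ℤ
      K = + (r !) * + (r !) * (+ suc r * + d)
      0<r! : 0ℤ < + (r !)
      0<r! = +<+ (ℕ.1≤n! r)
      0<K : 0ℤ < K
      0<K = *-pos (*-pos 0<r! 0<r!) (*-pos {+ suc r} (+<+ (ℕ.s≤s ℕ.z≤n)) 0<d)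
      factored : (+ (suc r !) * (+ d * + I (suc r))) * (+ (suc r !) * (+ d * + I (suc r)))
                 - (+ (r !) * (+ suc d * + I r)) * (+ (suc (suc r) !) * (+ d * + I (suc (suc r))))
               ≡ K * ((+ suc r * + d) * (+ I (suc r) * + I (suc r))
                      - (+ suc (suc r) * + suc d) * (+ I r * + I (suc (suc r))))
      factored = trans
        (cong₂ (λ u v → (u * (+ d * + I (suc r))) * (u * (+ d * + I (suc r)))
                        - (+ (r !) * (+ suc d * + I r)) * (v * (+ d * + I (suc (suc r)))))
          (pos-* (suc r) (r !))
          (trans (pos-* (suc (suc r)) (suc r !)) (cong (+ suc (suc r) *_) (pos-* (suc r) (r !)))))
        (solve 6 (λ f r d x y z → let r+1 = con 1ℤ :+ r ; r+2 = con (+ 2) :+ r ; d+1 = con 1ℤ :+ d in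
            ((r+1 :* f) :* (d :* y)) :* ((r+1 :* f) :* (d :* y)) :- (f :* (d+1 :* x)) :* ((r+2 :* (r+1 :* f)) :* (d :* z))
            := (f :* f :* (r+1 :* d)) :* ((r+1 :* d) :* (y :* y) :- (r+2 :* d+1) :* (x :* z)))
          refl (+ (r !)) (+ r) (+ d) (+ I r) (+ I (suc r)) (+ I (suc (suc r))))

open import Data.Fin.Base using (Fin)
open import Data.Integer.Base using (1ℤ)
open import Data.Nat.Base using (ℕ; suc; _+_; _∸_; _^_; _<_; NonZero; >-nonZero; ≢-nonZero⁻¹) renaming (_≤_ to _≤ℕ_)
open import Data.Nat.Properties using (+-comm; m+[n∸m]≡n; <⇒≤; m∸n≢0⇒n<m)
open import Data.Rational.Base using (1ℚ; _≥_; _/_) renaming (_+_ to _+ℚ_; _*_ to _*ℚ_; _≤_ to _≤ℚ_)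
open import Data.Vec.Functional using (Vector)
open import Relation.Binary.PropositionalEquality using (subst)
open UltraLogConcavity

corollary1p13 : ∀ {c ℓ₁ ℓ₂} (q : ℕ) (q-primePower : IsPrimePower q) (F : FiniteField c ℓ₁ ℓ₂ q)
    (m n : ℕ) → 1 ≤ℕ m →
    (X : Fin n → Vector (FiniteField.Carrier F) m) →
    let open VectorSet F X in
    IsSet → Spanning →
    ∀ k (1≤k : 1 ≤ℕ k) (k<m : k < m) →
    ℕ→ℚ (I k) *ℚ ℕ→ℚ (I k) ≥
    (1ℚ +ℚ (1ℤ / k) {{>-nonZero 1≤k}})
    *ℚ (1ℚ +ℚ (1ℤ / (q ^ (m ∸ k + 1) ∸ 2)) {{q^[m-k+1]-2-nonZero q-primePower k<m}})
    *ℚ ℕ→ℚ (I (k ∸ 1)) *ℚ ℕ→ℚ (I (k + 1))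
corollary1p13 q pp F m n _ X _ _ (suc r) _ k<m = subst
  (λ j → (1ℚ +ℚ 1ℤ / suc r) *ℚ (1ℚ +ℚ 1ℤ / d) *ℚ ℕ→ℚ (I r) *ℚ ℕ→ℚ (I j) ≤ℚ ℕ→ℚ (I (suc r)) *ℚ ℕ→ℚ (I (suc r)))
  (+-comm 1 (suc r))
  (ℕ⇒ℚ-inequality (suc r) d (I r) (I (suc r)) (I (suc (suc r))) ultraLogConcave)
  where
  open VectorSet F X
  d = q ^ (m ∸ suc r + 1) ∸ 2
  instance
    d≢0 : NonZero d
    d≢0 = q^[m-k+1]-2-nonZero pp k<m
  -- The truncated difference d is nonzero, so q^(m-k+1) exceeds 2 and 2 + d recovers it.
  open UltraLogConcave F X r d k<m (m+[n∸m]≡n {2} (<⇒≤ (m∸n≢0⇒n<m (≢-nonZero⁻¹ d))))
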